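{- Let $d\ge 1$, let $V$ be a $d$-dimensional real inner-product space, $\mathcal L\subset V$ a full-rank lattice, $\boldsymbol\alpha\in V$, and suppose that the sequence $q_1<q_2<\cdots$ of best approximation denominators of $\boldsymbol\alpha$ with respect to $\mathcal L$ is infinite. Then $$ \liminf_{n\to\infty} q_n^{1/n}\ \ge\ \begin{cases} \dfrac{1+\sqrt5}{2}, & d=1,\\[2mm] 2^{1/(2^d-1)}, & d\ge 2.\end{cases} $$
   Context: Let $\|\cdot\|$ be the norm induced by the inner product of $V$; a full-rank lattice is a discrete subgroup spanning $V$. For integers $q\ge 1$ put $\rho(q)=\min_{p\in\mathcal L}\|q\boldsymbol\alpha-p\|$. The best approximation denominators are defined by $q_1=1$ and $$q_{n+1}=\min\{q\in\mathbb Z: q>q_n,\ \rho(q)<\rho(q_n)\}$$ whenever the set on the right is nonempty; if it is empty, the sequence terminates at $q_n$. -}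

module Defs where

open import Algebra.Bundles using (CommutativeRing)
open import Algebra.Module.Bundles using (Module)
import Algebra.Definitions.RawMonoid as RawMonoidDefs
import Algebra.Properties.Semiring.Exp as SemiringExp
open import Axiom.ExcludedMiddle using (ExcludedMiddle)
open import Data.Nat.Base as ℕ using (ℕ; suc)
open import Data.Product.Base using (Σ; ∃; ∃-syntax; _×_; _,_; proj₁)
open import Data.Vec.Functional using (Vector)
open import Level using (0ℓ)
import Relation.Binary.Construct.Add.Extrema.NonStrict as AddExtrema
import Relation.Binary.Construct.NonStrictToStrict as ToStrict
open import Relation.Binary.Core using (Rel)
open import Relation.Binary.Definitions using (_Respects_)
open import Relation.Binary.PropositionalEquality.Core using (_≡_)
open import Relation.Binary.Structures using (IsTotalOrder)
open import Relation.Nullary.Construct.Add.Extrema using (_±; [_])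
open import Relation.Nullary.Decidable.Core using (yes; no)
open import Relation.Unary using (Pred; Satisfiable; _∈_)

module _ {A : Set} (_≤_ : Rel A 0ℓ) where

  IsUpperBound : Pred A 0ℓ → A → Set
  IsUpperBound S u = ∀ x → x ∈ S → x ≤ u

  IsLowerBound : Pred A 0ℓ → A → Set
  IsLowerBound S l = ∀ x → x ∈ S → l ≤ x

  IsSup : Pred A 0ℓ → A → Set
  IsSup S s = IsUpperBound S s × (∀ u → IsUpperBound S u → s ≤ u)

  IsInf : Pred A 0ℓ → A → Set
  IsInf S i = IsLowerBound S i × (∀ l → IsLowerBound S l → l ≤ i)

  IsMin : Pred A 0ℓ → A → Set
  IsMin S m = m ∈ S × IsLowerBound S m

-- The real numbers, which the standard library lacks, are given by the axioms
-- characterising them up to unique isomorphism.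
record CompleteOrderedField : Set₁ where
  infix 4 _≤_
  field
    commutativeRing : CommutativeRing 0ℓ 0ℓ

  open CommutativeRing commutativeRing public

  field
    1≉0          : 1# ≉ 0#
    inverse      : ∀ x → x ≉ 0# → ∃[ y ] x * y ≈ 1#
    _≤_          : Rel Carrier 0ℓ
    isTotalOrder : IsTotalOrder _≈_ _≤_
    +-monoˡ-≤    : ∀ z {x y} → x ≤ y → x + z ≤ y + z
    *-nonNeg     : ∀ {x y} → 0# ≤ x → 0# ≤ y → 0# ≤ x * y
    complete     : (S : Pred Carrier 0ℓ) → Satisfiable S →
                   ∃ (IsUpperBound _≤_ S) → ∃ (IsSup _≤_ S)

  open ToStrict _≈_ _≤_ public
    using () renaming (_<_ to infix 4 _<_)
  open AddExtrema _≤_ public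
    using () renaming (_≤±_ to infix 4 _≤±_)
  open SemiringExp semiring public
    using (_^_)

  fromℕ : ℕ → Carrier
  fromℕ n = RawMonoidDefs._×_ +-rawMonoid n 1#

-- Excluded middle is assumed throughout, as in ordinary real analysis; here it
-- makes partial operations total.
module RealFunctions (em : ExcludedMiddle 0ℓ) (ℝ : CompleteOrderedField) where
  open CompleteOrderedField ℝ

  infix 8 _⁻¹ √_

  -- Total, with 0⁻¹ = 0.
  _⁻¹ : Carrier → Carrier
  x ⁻¹ with em {x ≈ 0#}
  ... | yes _   = 0#
  ... | no x≉0 = proj₁ (inverse x x≉0)

  -- Total, with value 0 on sets that are empty or unbounded above.
  sup : Pred Carrier 0ℓ → Carrier
  sup S with em {Satisfiable S × ∃ (IsUpperBound _≤_ S)}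
  ... | yes (nonempty , bounded) = proj₁ (complete S nonempty bounded)
  ... | no _                     = 0#

  -- The nonnegative n-th root; meaningful for n ≥ 1 and x ≥ 0.
  root : ℕ → Carrier → Carrier
  root n x = sup (λ y → 0# ≤ y × y ^ n ≤ x)

  √_ : Carrier → Carrier
  √ x = root 2 x

  -- ℓ = sup_N inf_{k ≥ N} a k, all taken in the extended reals.
  IsLiminf : (ℕ → Carrier) → Carrier ± → Set
  IsLiminf a ℓ =
    Σ (ℕ → Carrier ±) λ b →
      (∀ N → IsInf _≤±_ (λ y → ∃[ k ] N ℕ.≤ k × y ≡ [ a k ]) (b N)) ×
      IsSup _≤±_ (λ y → ∃[ N ] y ≡ b N) ℓ

  -- The second clause is meant for d ≥ 2.
  growthBound : ℕ → Carrier
  growthBound 1 = (1# + √ fromℕ 5) * fromℕ 2 ⁻¹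
  growthBound d = root (2 ℕ.^ d ℕ.∸ 1) (fromℕ 2)

record InnerProductSpace (ℝ : CompleteOrderedField) : Set₁ where
  open CompleteOrderedField ℝ

  field
    vectorSpace : Module commutativeRing 0ℓ 0ℓ

  open Module vectorSpace public

  field
    ⟨_,_⟩       : Carrierᴹ → Carrierᴹ → Carrier
    ⟨⟩-cong     : ∀ {u u′ v v′} → u ≈ᴹ u′ → v ≈ᴹ v′ → ⟨ u , v ⟩ ≈ ⟨ u′ , v′ ⟩
    ⟨⟩-sym      : ∀ u v → ⟨ u , v ⟩ ≈ ⟨ v , u ⟩
    ⟨⟩-+        : ∀ u v w → ⟨ u +ᴹ v , w ⟩ ≈ ⟨ u , w ⟩ + ⟨ v , w ⟩
    ⟨⟩-*ₗ       : ∀ c u v → ⟨ c *ₗ u , v ⟩ ≈ c * ⟨ u , v ⟩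
    ⟨⟩-nonNeg   : ∀ v → 0# ≤ ⟨ v , v ⟩
    ⟨⟩-definite : ∀ v → ⟨ v , v ⟩ ≈ 0# → v ≈ᴹ 0ᴹ

  linearCombination : ∀ {n} → Vector Carrier n → Vector Carrierᴹ n → Carrierᴹ
  linearCombination c v = RawMonoidDefs.sum +ᴹ-rawMonoid (λ i → c i *ₗ v i)

  IsBasis : ∀ {n} → Vector Carrierᴹ n → Set
  IsBasis b =
    (∀ c → linearCombination c b ≈ᴹ 0ᴹ → ∀ i → c i ≈ 0#) ×
    (∀ v → ∃[ c ] v ≈ᴹ linearCombination c b)

  HasDimension : ℕ → Set
  HasDimension d = Σ (Vector Carrierᴹ d) IsBasis

module Approximation (em : ExcludedMiddle 0ℓ) (ℝ : CompleteOrderedField)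
                     (V : InnerProductSpace ℝ) where
  open CompleteOrderedField ℝ
  open RealFunctions em ℝ
  open InnerProductSpace V

  ‖_‖ : Carrierᴹ → Carrier
  ‖ v ‖ = √ ⟨ v , v ⟩

  record IsFullRankLattice (L : Pred Carrierᴹ 0ℓ) : Set where
    field
      respects   : L Respects _≈ᴹ_
      0-closed   : 0ᴹ ∈ L
      +-closed   : ∀ {u v} → u ∈ L → v ∈ L → u +ᴹ v ∈ L
      neg-closed : ∀ {v} → v ∈ L → -ᴹ v ∈ L
      discrete   : ∀ p → p ∈ L → ∃[ ε ] 0# < ε ×
                   (∀ p′ → p′ ∈ L → ‖ p′ +ᴹ -ᴹ p ‖ < ε → p′ ≈ᴹ p)
      spanning   : ∀ v → ∃[ n ] Σ (Vector Carrier n) λ c →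
                   Σ (Vector Carrierᴹ n) λ w →
                   (∀ i → w i ∈ L) × v ≈ᴹ linearCombination c w

  -- Isρ L α q r says that ρ(q) is attained and equals r.
  Isρ : Pred Carrierᴹ 0ℓ → Carrierᴹ → ℕ → Carrier → Set
  Isρ L α q = IsMin _≤_ (λ r → ∃[ p ] p ∈ L × r ≈ ‖ fromℕ q *ₗ α +ᴹ -ᴹ p ‖)

  Improves : Pred Carrierᴹ 0ℓ → Carrierᴹ → ℕ → ℕ → Set
  Improves L α q₀ q =
    q₀ ℕ.< q × ∃[ r ] ∃[ r₀ ] Isρ L α q r × Isρ L α q₀ r₀ × r < r₀

  -- An infinite sequence of best approximation denominators, indexed from 0:
  -- q n stands for the usual q_{n+1}.
  record IsBestApproximationSequence
           (L : Pred Carrierᴹ 0ℓ) (α : Carrierᴹ) (q : ℕ → ℕ) : Set where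
    field
      first : q 0 ≡ 1
      next  : ∀ n → IsMin ℕ._≤_ (Improves L α (q n)) (q (suc n))

{-# OPTIONS --safe #-}

-- Write m_j = (q_j, p_j) for the j-th best approximation vector in ℤ × L, r_j = q_j α - p_j for
-- its residual, and put M = 2ᵈ, K = M/2. The heart of the matter is that for every n
--     q_{n+M} ≥ 2 q_{n+1}   or   q_{n+M} ≥ q_n + q_{n+K}.
-- Suppose the first inequality fails. Halving a congruence mod 2 between the vectors m_n, …, m_{n+M}
-- produces lattice vectors with denominator below q_{n+1}, hence with long residuals; the
-- parallelogram law then shows that no two of these vectors are congruent and that a relation
-- m_i + m_j + m_k ≡ 0 forces q_k = q_i + q_j, so that i = n for i < j < k. As (ℤ × L)/2 has at most
-- 2M classes, for each j in (n, n+M] the 2M + 1 vectors m_n, …, m_{n+M}, m_j + m_{n+1}, …,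
-- m_j + m_{n+M} contain a congruent pair, so q_j differs by q_n from some other denominator in the
-- window; by pigeonhole one of the K + 1 largest denominators q_j has q_j + q_n in the window.
--
-- If y ≥ 1 satisfies y^M ≤ 2y and y^M ≤ 1 + y^K, the dichotomy gives yⁿ ≤ y^M q_n by induction.
-- For d = 1 this is y² ≤ 1 + y; for d ≥ 2 both follow from y^{M-1} ≤ 2, as y^K ≥ y² ≥ 2y - 1.
module Submission where

open import Algebra.Bundles using (AbelianGroup)
import Algebra.Construct.DirectProduct as DirectProduct
import Algebra.Properties.AbelianGroup as AbelianGroupProperties
import Algebra.Properties.CommutativeSemigroup as CommutativeSemigroupProperties
import Algebra.Properties.Ring as RingProperties
import Algebra.Properties.Semiring.Exp as SemiringExp
import Algebra.Properties.Semiring.Mult as SemiringMult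
import Algebra.Solver.Ring as RingSolver
open import Algebra.Solver.Ring.AlmostCommutativeRing using (fromCommutativeRing; _-Raw-AlmostCommutative⟶_)
open import Axiom.ExcludedMiddle using (ExcludedMiddle)
open import Data.Empty using (⊥; ⊥-elim)
open import Data.Fin.Base as Fin using (Fin; zero; suc; toℕ; fromℕ<; finToFun; funToFin)
import Data.Fin.Properties as Fin
open import Data.Integer.Base as ℤ using (ℤ; +_; -[1+_])
import Data.Integer.Properties as ℤ
import Data.Integer.Solver as ℤSolver
open import Data.Maybe.Base using (Maybe; just; nothing)
open import Data.Nat.Base as ℕ using (ℕ; zero; suc; s≤s; z≤n)
open import Data.Nat.Induction using (<-rec)
import Data.Nat.Properties as ℕ
import Data.Nat.Solver as ℕSolver
open import Data.Product.Base using (Σ; ∃; ∃₂; ∃-syntax; _×_; _,_; proj₁; proj₂)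
open import Data.Sum.Base using (_⊎_; inj₁; inj₂)
open import Data.Vec.Functional using (Vector)
open import Function.Base using (_∘_)
open import Level using (0ℓ)
open import Relation.Binary.Bundles using (Poset)
import Relation.Binary.Construct.Add.Extrema.NonStrict as AddExtrema
import Relation.Binary.Construct.Add.Supremum.NonStrict as AddSupremum
import Relation.Binary.Construct.NonStrictToStrict as ToStrict
open import Relation.Binary.Definitions using (tri<; tri≈; tri>)
open import Relation.Binary.PropositionalEquality.Core as ≡ using (_≡_; _≢_)
import Relation.Binary.Reasoning.PartialOrder as PosetReasoning
import Relation.Binary.Reasoning.Setoid as SetoidReasoning
open import Relation.Binary.Structures using (IsTotalOrder)
open import Relation.Nullary using (¬_; yes; no; contradiction)
open import Relation.Nullary.Construct.Add.Extrema using ([_]; ⊥±; ⊤±)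
open import Relation.Unary using (Pred; Satisfiable; _∈_)
open import Defs

-- The lattice is given as a discrete subgroup that spans, so no integral basis is at hand to count
-- the classes of (ℤ × L)/2. The count is extracted from discreteness instead: more than 2M pairwise
-- incongruent elements would serve as digits of too many expansions inside one box. The same
-- pigeonhole in boxes shows that every point has a nearest lattice point. This matters because an
-- improvement, in the definition of q_{n+1}, presupposes that ρ is attained at the denominator in
-- question. Both arguments need coordinates that are linear, bounded by the norm, and able to force
-- the norm to be small; inner products with suitable vectors f_i, obtained from an orthogonal
-- projection, have all three properties.
--
-- The constant y^M in yⁿ ≤ y^M q_n would spoil a comparison at the exact rate. It suffices,
-- however, that every x below the claimed bound is eventually below the n-th roots, and a rate y
-- strictly above x leaves an exponential gap that absorbs the constant.

-- Arithmetic of an ordered field and the Archimedean property.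

module OrderedField (em : ExcludedMiddle 0ℓ) (ℝ : CompleteOrderedField) where
  open CompleteOrderedField ℝ hiding (zero)
  open IsTotalOrder isTotalOrder public using (total; antisym; isPartialOrder)
    renaming (refl to ≤-refl; trans to ≤-trans; reflexive to ≤-reflexive;
              ≤-respˡ-≈ to ≤-respˡ; ≤-respʳ-≈ to ≤-respʳ)
  open RingProperties ring public using (-‿distribˡ-*; -‿distribʳ-*)
  open AbelianGroupProperties +-abelianGroup public using (⁻¹-involutive; ⁻¹-∙-comm; ε⁻¹≈ε)
  open SemiringMult semiring using (×-homo-+; ×1-homo-*)
  open SemiringExp semiring public using (^-homo-*; ^-congˡ)

  poset : Poset 0ℓ 0ℓ 0ℓ
  poset = record { isPartialOrder = isPartialOrder }

  fromℤ : ℤ → Carrier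
  fromℤ (+ n)    = fromℕ n
  fromℤ -[1+ n ] = - fromℕ (suc n)

  fromℕ-+ : ∀ m n → fromℕ (m ℕ.+ n) ≈ fromℕ m + fromℕ n
  fromℕ-+ = ×-homo-+ 1#

  fromℕ-* : ∀ m n → fromℕ (m ℕ.* n) ≈ fromℕ m * fromℕ n
  fromℕ-* = ×1-homo-*

  fromℤ-⊖ : ∀ m n → fromℤ (m ℤ.⊖ n) ≈ fromℕ m - fromℕ n
  fromℤ-⊖ zero    zero    = sym (-‿inverseʳ 0#)
  fromℤ-⊖ zero    (suc n) = sym (+-identityˡ _)
  fromℤ-⊖ (suc m) zero    = trans (sym (+-identityʳ _)) (+-congˡ (sym ε⁻¹≈ε))
  fromℤ-⊖ (suc m) (suc n) rewrite ℤ.[1+m]⊖[1+n]≡m⊖n m n = trans (fromℤ-⊖ m n) (sym (begin-equality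
    (1# + fromℕ m) + - (1# + fromℕ n)     ≈⟨ +-cong (+-comm _ _) (sym (⁻¹-∙-comm _ _)) ⟩
    (fromℕ m + 1#) + (- 1# + - fromℕ n)   ≈⟨ +-assoc _ _ _ ⟩
    fromℕ m + (1# + (- 1# + - fromℕ n))   ≈⟨ +-congˡ (sym (+-assoc _ _ _)) ⟩
    fromℕ m + ((1# + - 1#) + - fromℕ n)   ≈⟨ +-congˡ (+-congʳ (-‿inverseʳ 1#)) ⟩
    fromℕ m + (0# + - fromℕ n)            ≈⟨ +-congˡ (+-identityˡ _) ⟩
    fromℕ m + - fromℕ n                   ∎))
    where open PosetReasoning poset

  fromℤ-neg : ∀ x → fromℤ (ℤ.- x) ≈ - fromℤ x
  fromℤ-neg (+ zero)  = sym ε⁻¹≈ε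
  fromℤ-neg (+ suc n) = refl
  fromℤ-neg -[1+ n ]  = sym (⁻¹-involutive _)

  fromℤ-+ : ∀ x y → fromℤ (x ℤ.+ y) ≈ fromℤ x + fromℤ y
  fromℤ-+ (+ m)    (+ n)    = fromℕ-+ m n
  fromℤ-+ (+ m)    -[1+ n ] = fromℤ-⊖ m (suc n)
  fromℤ-+ -[1+ m ] (+ n)    = trans (fromℤ-⊖ n (suc m)) (+-comm _ _)
  fromℤ-+ -[1+ m ] -[1+ n ] = begin-equality
    - fromℕ (suc (suc (m ℕ.+ n)))          ≡⟨ ≡.cong (λ k → - fromℕ (suc k)) (≡.sym (ℕ.+-suc m n)) ⟩
    - fromℕ (suc m ℕ.+ suc n)              ≈⟨ -‿cong (fromℕ-+ (suc m) (suc n)) ⟩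
    - (fromℕ (suc m) + fromℕ (suc n))      ≈⟨ sym (⁻¹-∙-comm _ _) ⟩
    - fromℕ (suc m) + - fromℕ (suc n)      ∎
    where open PosetReasoning poset

  fromℤ-pos-* : ∀ m y → fromℤ (+ m ℤ.* y) ≈ fromℕ m * fromℤ y
  fromℤ-pos-* m (+ n) rewrite ≡.sym (ℤ.pos-* m n) = fromℕ-* m n
  fromℤ-pos-* m -[1+ n ] = begin-equality
    fromℤ (+ m ℤ.* -[1+ n ])           ≡⟨ ≡.cong fromℤ (≡.sym (ℤ.neg-distribʳ-* (+ m) (+ suc n))) ⟩
    fromℤ (ℤ.- (+ m ℤ.* + suc n))      ≈⟨ fromℤ-neg (+ m ℤ.* + suc n) ⟩
    - fromℤ (+ m ℤ.* + suc n)          ≈⟨ -‿cong (fromℤ-pos-* m (+ suc n)) ⟩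
    - (fromℕ m * fromℕ (suc n))        ≈⟨ -‿distribʳ-* _ _ ⟩
    fromℕ m * - fromℕ (suc n)          ∎
    where open PosetReasoning poset

  fromℤ-* : ∀ x y → fromℤ (x ℤ.* y) ≈ fromℤ x * fromℤ y
  fromℤ-* (+ m) y = fromℤ-pos-* m y
  fromℤ-* -[1+ m ] y = begin-equality
    fromℤ (-[1+ m ] ℤ.* y)             ≡⟨ ≡.cong fromℤ (≡.sym (ℤ.neg-distribˡ-* (+ suc m) y)) ⟩
    fromℤ (ℤ.- (+ suc m ℤ.* y))        ≈⟨ fromℤ-neg (+ suc m ℤ.* y) ⟩
    - fromℤ (+ suc m ℤ.* y)            ≈⟨ -‿cong (fromℤ-pos-* (suc m) y) ⟩
    - (fromℕ (suc m) * fromℤ y)        ≈⟨ -‿distribˡ-* _ _ ⟩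
    - fromℕ (suc m) * fromℤ y          ∎
    where open PosetReasoning poset

  -- Integer coefficients are decidable, so the solver sees cancellations.
  private
    ℤ⟶ℝ : ℤ.+-*-rawRing -Raw-AlmostCommutative⟶ fromCommutativeRing commutativeRing
    ℤ⟶ℝ = record
      { ⟦_⟧ = fromℤ ; +-homo = fromℤ-+ ; *-homo = fromℤ-* ; -‿homo = fromℤ-neg
      ; 0-homo = refl ; 1-homo = +-identityʳ 1# }

    coefficients≟ : ∀ x y → Maybe (fromℤ x ≈ fromℤ y)
    coefficients≟ x y with x ℤ.≟ y
    ... | yes ≡.refl = just refl
    ... | no _       = nothing

  open RingSolver ℤ.+-*-rawRing (fromCommutativeRing commutativeRing) ℤ⟶ℝ coefficients≟ public
    using (solve; _:=_; con; _:+_; _:*_; _:-_; :-_; Polynomial)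

  :1 :2 : ∀ {n} → Polynomial n
  :1 = con (+ 1)
  :2 = con (+ 2)

  -- `fromℕ 1` unfolds to `1# + 0#`, and the solver reads its constant 1 as `fromℕ 1`. Calculations
  -- therefore pass through `fromℕ 1` or hand `1#` to the solver as a variable.
  fromℕ-1 : fromℕ 1 ≈ 1#
  fromℕ-1 = +-identityʳ 1#

  ≰⇒> : ∀ {x y} → ¬ x ≤ y → y < x
  ≰⇒> = ToStrict.≰⇒> _≈_ _≤_ sym ≤-reflexive total

  <⇒≱ : ∀ {x y} → x < y → ¬ y ≤ x
  <⇒≱ = ToStrict.<⇒≱ _≈_ _≤_ antisym

  ≮⇒≥ : ∀ {x y} → ¬ x < y → y ≤ x
  ≮⇒≥ {x} {y} x≮y with em {y ≤ x}
  ... | yes y≤x = y≤x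
  ... | no y≰x = contradiction (≰⇒> y≰x) x≮y

  <⇒≤ : ∀ {x y} → x < y → x ≤ y
  <⇒≤ = proj₁

  <-≤-trans : ∀ {x y z} → x < y → y ≤ z → x < z
  <-≤-trans = ToStrict.<-≤-trans _≈_ _≤_ sym ≤-trans antisym ≤-respʳ

  ≤-<-trans : ∀ {x y z} → x ≤ y → y < z → x < z
  ≤-<-trans = ToStrict.≤-<-trans _≈_ _≤_ ≤-trans antisym ≤-respˡ

  -- Reduces an inequality to a visibly nonnegative difference and a ring identity, which is left to
  -- the solver.
  ≤-by : ∀ {x y t} → 0# ≤ t → x + t ≈ y → x ≤ y
  ≤-by {x} {y} {t} 0≤t x+t≈y = begin
    x       ≈⟨ sym (+-identityˡ x) ⟩
    0# + x  ≤⟨ +-monoˡ-≤ x 0≤t ⟩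
    t + x   ≈⟨ +-comm t x ⟩
    x + t   ≈⟨ x+t≈y ⟩
    y       ∎
    where open PosetReasoning poset

  0≤y-x : ∀ {x y} → x ≤ y → 0# ≤ y - x
  0≤y-x {x} x≤y = ≤-respˡ (-‿inverseʳ x) (+-monoˡ-≤ (- x) x≤y)

  0<y-x : ∀ {x y} → x < y → 0# < y - x
  0<y-x {x} {y} (x≤y , x≉y) = 0≤y-x x≤y , λ eq → x≉y (begin-equality
    x              ≈⟨ +-identityˡ x ⟨
    0# + x         ≈⟨ +-congʳ eq ⟩
    (y - x) + x    ≈⟨ solve 2 (λ x y → (y :- x) :+ x := y) refl x y ⟩
    y              ∎)
    where open PosetReasoning poset

  +-mono-≤ : ∀ {a b x y} → a ≤ b → x ≤ y → a + x ≤ b + y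
  +-mono-≤ {a} {b} {x} {y} a≤b x≤y = ≤-trans (+-monoˡ-≤ x a≤b)
    (≤-by (0≤y-x x≤y) (solve 3 (λ b x y → (b :+ x) :+ (y :- x) := b :+ y) refl b x y))

  0≤+ : ∀ {x y} → 0# ≤ x → 0# ≤ y → 0# ≤ x + y
  0≤+ 0≤x 0≤y = ≤-respˡ (+-identityʳ 0#) (+-mono-≤ 0≤x 0≤y)

  x≤x+y : ∀ {x y} → 0# ≤ y → x ≤ x + y
  x≤x+y 0≤y = ≤-by 0≤y refl

  neg-mono-≤ : ∀ {x y} → x ≤ y → - y ≤ - x
  neg-mono-≤ {x} {y} x≤y = ≤-by (0≤y-x x≤y) (solve 2 (λ x y → :- y :+ (y :- x) := :- x) refl x y)

  *-monoʳ-≤ : ∀ {z x y} → 0# ≤ z → x ≤ y → z * x ≤ z * y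
  *-monoʳ-≤ {z} {x} {y} 0≤z x≤y = ≤-by (*-nonNeg 0≤z (0≤y-x x≤y))
    (solve 3 (λ z x y → z :* x :+ z :* (y :- x) := z :* y) refl z x y)

  *-mono-≤ : ∀ {a b x y} → 0# ≤ a → 0# ≤ y → a ≤ b → x ≤ y → a * x ≤ b * y
  *-mono-≤ {a} {b} {x} {y} 0≤a 0≤y a≤b x≤y = ≤-trans (*-monoʳ-≤ 0≤a x≤y)
    (≤-by (*-nonNeg 0≤y (0≤y-x a≤b)) (solve 3 (λ a b y → a :* y :+ y :* (b :- a) := b :* y) refl a b y))

  0≤x² : ∀ x → 0# ≤ x * x
  0≤x² x with total 0# x
  ... | inj₁ 0≤x = *-nonNeg 0≤x 0≤x
  ... | inj₂ x≤0 = ≤-respʳ (solve 1 (λ x → (con (+ 0) :- x) :* (con (+ 0) :- x) := x :* x) refl x)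
                     (*-nonNeg (0≤y-x x≤0) (0≤y-x x≤0))

  0≤1 : 0# ≤ 1#
  0≤1 = ≤-respʳ (*-identityˡ 1#) (0≤x² 1#)

  0<1 : 0# < 1#
  0<1 = 0≤1 , λ eq → 1≉0 (sym eq)

  0≤fromℕ : ∀ n → 0# ≤ fromℕ n
  0≤fromℕ zero    = ≤-refl
  0≤fromℕ (suc n) = 0≤+ 0≤1 (0≤fromℕ n)

  fromℕ-mono-≤ : ∀ {m n} → m ℕ.≤ n → fromℕ m ≤ fromℕ n
  fromℕ-mono-≤ {n = n} z≤n = 0≤fromℕ n
  fromℕ-mono-≤ {suc m} {suc n} (s≤s m≤n) = +-mono-≤ ≤-refl (fromℕ-mono-≤ {m} {n} m≤n)

  1≤fromℕ : ∀ {n} → 1 ℕ.≤ n → 1# ≤ fromℕ n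
  1≤fromℕ {n} 1≤n = ≤-respˡ fromℕ-1 (fromℕ-mono-≤ {1} {n} 1≤n)

  0<x+y : ∀ {x y} → 0# < x → 0# ≤ y → 0# < x + y
  0<x+y 0<x 0≤y = <-≤-trans 0<x (x≤x+y 0≤y)

  0<2 : 0# < fromℕ 2
  0<2 = 0<x+y 0<1 (0≤fromℕ 1)

  x*y≈0⇒y≈0 : ∀ {x y} → x ≉ 0# → x * y ≈ 0# → y ≈ 0#
  x*y≈0⇒y≈0 {x} {y} x≉0 xy≈0 with inverse x x≉0
  ... | x⁻¹ , x*x⁻¹≈1 = begin-equality
    y                ≈⟨ *-identityˡ y ⟨
    1# * y           ≈⟨ *-congʳ x*x⁻¹≈1 ⟨
    (x * x⁻¹) * y    ≈⟨ solve 3 (λ x x⁻¹ y → (x :* x⁻¹) :* y := x⁻¹ :* (x :* y)) refl x x⁻¹ y ⟩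
    x⁻¹ * (x * y)    ≈⟨ *-congˡ xy≈0 ⟩
    x⁻¹ * 0#         ≈⟨ zeroʳ x⁻¹ ⟩
    0#               ∎
    where open PosetReasoning poset

  0<x*y : ∀ {x y} → 0# < x → 0# < y → 0# < x * y
  0<x*y (0≤x , 0≉x) (0≤y , 0≉y) = *-nonNeg 0≤x 0≤y , λ eq → 0≉y (sym (x*y≈0⇒y≈0 (λ x≈0 → 0≉x (sym x≈0)) (sym eq)))

  *-cancelˡ-≤ : ∀ {z x y} → 0# < z → z * x ≤ z * y → x ≤ y
  *-cancelˡ-≤ {z} {x} {y} 0<z zx≤zy = ≮⇒≥ λ y<x → <⇒≱ (0<x*y 0<z (0<y-x y<x))
    (≤-by (0≤y-x zx≤zy) (solve 3 (λ z x y → z :* (x :- y) :+ (z :* y :- z :* x) := con (+ 0)) refl z x y))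

  *-cancelˡ-≈ : ∀ {z x y} → 0# < z → z * x ≈ z * y → x ≈ y
  *-cancelˡ-≈ 0<z eq = antisym (*-cancelˡ-≤ 0<z (≤-reflexive eq)) (*-cancelˡ-≤ 0<z (≤-reflexive (sym eq)))

  square-mono-≤ : ∀ {x y} → 0# ≤ x → x ≤ y → x * x ≤ y * y
  square-mono-≤ 0≤x x≤y = *-mono-≤ 0≤x (≤-trans 0≤x x≤y) x≤y x≤y

  square-cancel-≤ : ∀ {x y} → 0# ≤ y → x * x ≤ y * y → x ≤ y
  square-cancel-≤ {x} {y} 0≤y xx≤yy = ≮⇒≥ λ y<x → <⇒≱ (0<x*y (0<y-x y<x) (<-≤-trans (≤-<-trans 0≤y y<x) (x≤x+y 0≤y)))
    (≤-by (0≤y-x xx≤yy) (solve 2 (λ x y → (x :- y) :* (x :+ y) :+ (y :* y :- x :* x) := con (+ 0)) refl x y))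

  0≤^ : ∀ {x} n → 0# ≤ x → 0# ≤ x ^ n
  0≤^ zero    0≤x = 0≤1
  0≤^ (suc n) 0≤x = *-nonNeg 0≤x (0≤^ n 0≤x)

  0<^ : ∀ {x} n → 0# < x → 0# < x ^ n
  0<^ zero    0<x = 0<1
  0<^ (suc n) 0<x = 0<x*y 0<x (0<^ n 0<x)

  1≤^ : ∀ {x} n → 1# ≤ x → 1# ≤ x ^ n
  1≤^ zero    1≤x = ≤-refl
  1≤^ (suc n) 1≤x = ≤-respˡ (*-identityˡ 1#) (*-mono-≤ 0≤1 (0≤^ n (≤-trans 0≤1 1≤x)) 1≤x (1≤^ n 1≤x))

  ^-monoʳ-≤ : ∀ {x m n} → 1# ≤ x → m ℕ.≤ n → x ^ m ≤ x ^ n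
  ^-monoʳ-≤ {n = n} 1≤x z≤n = 1≤^ n 1≤x
  ^-monoʳ-≤ 1≤x (s≤s m≤n) = *-monoʳ-≤ (≤-trans 0≤1 1≤x) (^-monoʳ-≤ 1≤x m≤n)

  -- Otherwise the multiples of δ have a supremum s, and since (n + 1)δ ≤ s for all n, the smaller
  -- number s - δ bounds them too.
  archimedean : ∀ {δ} x → 0# < δ → ∃[ n ] x < fromℕ n * δ
  archimedean {δ} x 0<δ with em {∃[ n ] x < fromℕ n * δ}
  ... | yes found = found
  ... | no none = contradiction s≤s-δ (<⇒≱ s-δ<s)
    where
    open PosetReasoning poset
    Multiple : Pred Carrier 0ℓ
    Multiple y = ∃[ n ] y ≈ fromℕ n * δ
    supremum : ∃ (IsSup _≤_ Multiple)
    supremum = complete Multiple (_ , 0 , refl) (x , λ { y (n , y≈nδ) → ≮⇒≥ λ x<y →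
      none (n , <-≤-trans x<y (≤-reflexive y≈nδ)) })
    s : Carrier
    s = proj₁ supremum
    s≤s-δ : s ≤ s - δ
    s≤s-δ = proj₂ (proj₂ supremum) (s - δ) λ { y (n , y≈nδ) → begin
      y                        ≈⟨ y≈nδ ⟩
      fromℕ n * δ              ≈⟨ solve 2 (λ n δ → n :* δ := (con (+ 1) :+ n) :* δ :- δ) refl (fromℕ n) δ ⟩
      (fromℕ 1 + fromℕ n) * δ - δ  ≈⟨ +-congʳ (*-congʳ (+-congʳ fromℕ-1)) ⟩
      fromℕ (suc n) * δ - δ    ≤⟨ +-monoˡ-≤ (- δ) (proj₁ (proj₂ supremum) _ (suc n , refl)) ⟩
      s - δ                    ∎ }
    s-δ<s : s - δ < s
    s-δ<s = ≰⇒> λ s≤ → <⇒≱ 0<δ (≤-by (0≤y-x s≤) (solve 2 (λ s δ → δ :+ ((s :- δ) :- s) := con (+ 0)) refl s δ))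

-- Roots as suprema.

module Roots (em : ExcludedMiddle 0ℓ) (ℝ : CompleteOrderedField) where
  open CompleteOrderedField ℝ hiding (zero)
  open RealFunctions em ℝ
  open OrderedField em ℝ

  divide : ∀ a {b} → 0# < b → ∃[ h ] b * h ≈ a
  divide a {b} (_ , 0≉b) with inverse b (λ b≈0 → 0≉b (sym b≈0))
  ... | c , bc≈1 = c * a , trans (sym (*-assoc b c a)) (trans (*-congʳ bc≈1) (*-identityˡ a))

  0<factor : ∀ {b h a} → 0# < b → b * h ≈ a → 0# < a → 0# < h
  0<factor {b} {h} {a} 0<b bh≈a 0<a = ≰⇒> λ h≤0 → <⇒≱ 0<a (begin
    a        ≈⟨ bh≈a ⟨
    b * h    ≤⟨ *-monoʳ-≤ (<⇒≤ 0<b) h≤0 ⟩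
    b * 0#   ≈⟨ zeroʳ b ⟩
    0#       ∎)
    where open PosetReasoning poset

  sup-isSup : (S : Pred Carrier 0ℓ) → Satisfiable S → ∃ (IsUpperBound _≤_ S) → IsSup _≤_ S (sup S)
  sup-isSup S nonempty bounded with em {Satisfiable S × ∃ (IsUpperBound _≤_ S)}
  ... | yes (nonempty′ , bounded′) = proj₂ (complete S nonempty′ bounded′)
  ... | no none                    = contradiction (nonempty , bounded) none

  root-isSup : ∀ n {x} → 0# ≤ x → IsSup _≤_ (λ y → 0# ≤ y × y ^ suc n ≤ x) (root (suc n) x)
  root-isSup n {x} 0≤x = sup-isSup _
    (0# , ≤-refl , ≤-respˡ (sym (zeroˡ _)) 0≤x)
    -- A y above 1 + x is at least 1, so its powers are at least y and exceed x.
    (1# + x , λ y (0≤y , yⁿ≤x) → ≮⇒≥ λ 1+x<y →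
      let 1≤y = ≤-trans (x≤x+y 0≤x) (<⇒≤ 1+x<y) in <⇒≱ 0<1 (begin
        1#             ≤⟨ ≤-by (0≤y-x yⁿ≤x) (solve 3 (λ e x p → e :+ (x :- p) := (e :+ x) :- p) refl 1# x (y ^ suc n)) ⟩
        (1# + x) - y ^ suc n ≤⟨ +-mono-≤ (<⇒≤ 1+x<y) (neg-mono-≤ (*-monoʳ-≤ 0≤y (1≤^ n 1≤y))) ⟩
        y - y * 1#     ≈⟨ trans (+-congˡ (-‿cong (*-identityʳ y))) (-‿inverseʳ y) ⟩
        0#             ∎))
    where open PosetReasoning poset

  root-upper : ∀ n {x y} → 0# ≤ y → y ^ suc n ≤ x → y ≤ root (suc n) x
  root-upper n 0≤y yⁿ≤x = proj₁ (root-isSup n (≤-trans (0≤^ (suc n) 0≤y) yⁿ≤x)) _ (0≤y , yⁿ≤x)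

  root-least : ∀ n {x u} → 0# ≤ x → (∀ y → 0# ≤ y → y ^ suc n ≤ x → y ≤ u) → root (suc n) x ≤ u
  root-least n 0≤x bound = proj₂ (root-isSup n 0≤x) _ λ y (0≤y , yⁿ≤x) → bound y 0≤y yⁿ≤x

  0≤root : ∀ n {x} → 0# ≤ x → 0# ≤ root (suc n) x
  0≤root n 0≤x = root-upper n ≤-refl (≤-respˡ (sym (zeroˡ _)) 0≤x)

  x^2≈x*x : ∀ x → x ^ 2 ≈ x * x
  x^2≈x*x x = *-congˡ (*-identityʳ x)

  √-square : ∀ {x} → 0# ≤ x → √ x * √ x ≈ x
  √-square {x} 0≤x = antisym (≮⇒≥ x≮s²) (≮⇒≥ s²≮x)
    where
    open PosetReasoning poset
    s : Carrier
    s = √ x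
    0≤s : 0# ≤ s
    0≤s = 0≤root 1 0≤x

    x≮s² : ¬ x < s * s
    x≮s² x<s² = <⇒≱ 0<h (≤-by (0≤y-x s≤s-h) (solve 2 (λ s h → h :+ ((s :- h) :- s) := con (+ 0)) refl s h))
      where
      0<s : 0# < s
      0<s = ≰⇒> λ s≤0 → <⇒≱ x<s² (begin
        s * s    ≤⟨ square-mono-≤ 0≤s s≤0 ⟩
        0# * 0#  ≈⟨ zeroˡ 0# ⟩
        0#       ≤⟨ 0≤x ⟩
        x        ∎)
      0<s+s : 0# < s + s
      0<s+s = 0<x+y 0<s 0≤s
      -- Solving 2sh = s² - x gives (s - h)² = x + h² ≥ x, so s - h still bounds the set whose
      -- supremum is s.
      h : Carrier
      h = proj₁ (divide (s * s - x) 0<s+s)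
      2sh≈s²-x : (s + s) * h ≈ s * s - x
      2sh≈s²-x = proj₂ (divide (s * s - x) 0<s+s)
      0<h : 0# < h
      0<h = 0<factor 0<s+s 2sh≈s²-x (0<y-x x<s²)
      h≤s : h ≤ s
      h≤s = *-cancelˡ-≤ 0<s+s (begin
        (s + s) * h        ≈⟨ 2sh≈s²-x ⟩
        s * s - x          ≤⟨ ≤-by (0≤+ 0≤x (0≤x² s)) (solve 2 (λ s x → (s :* s :- x) :+ (x :+ s :* s) := (s :+ s) :* s) refl s x) ⟩
        (s + s) * s        ∎)
      s≤s-h : s ≤ s - h
      s≤s-h = root-least 1 0≤x λ y 0≤y y²≤x → square-cancel-≤ (0≤y-x h≤s) (begin
        y * y                        ≈⟨ x^2≈x*x y ⟨
        y ^ 2                        ≤⟨ y²≤x ⟩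
        x                            ≤⟨ x≤x+y (0≤x² h) ⟩
        x + h * h                    ≈⟨ solve 3 (λ x s h → x :+ h :* h := (s :* s :- (s :* s :- x)) :+ h :* h) refl x s h ⟩
        (s * s - (s * s - x)) + h * h ≈⟨ +-congʳ (+-congˡ (-‿cong 2sh≈s²-x)) ⟨
        (s * s - (s + s) * h) + h * h ≈⟨ solve 2 (λ s h → (s :* s :- (s :+ s) :* h) :+ h :* h := (s :- h) :* (s :- h)) refl s h ⟩
        (s - h) * (s - h)            ∎)

    s²≮x : ¬ s * s < x
    s²≮x s²<x = <⇒≱ 0<h (≤-by (0≤y-x s+h≤s) (solve 2 (λ s h → h :+ (s :- (s :+ h)) := con (+ 0)) refl s h))
      where
      -- With h = (x - s²)/b, the summand x in b ensures h ≤ 1, and then 1 + 2s bounds the factor h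
      -- + 2s in (s + h)² = s² + h(h + 2s).
      b : Carrier
      b = 1# + (s + s + x)
      0<b : 0# < b
      0<b = 0<x+y 0<1 (0≤+ (0≤+ 0≤s 0≤s) 0≤x)
      h : Carrier
      h = proj₁ (divide (x - s * s) 0<b)
      bh≈x-s² : b * h ≈ x - s * s
      bh≈x-s² = proj₂ (divide (x - s * s) 0<b)
      0<h : 0# < h
      0<h = 0<factor 0<b bh≈x-s² (0<y-x s²<x)
      h≤1 : h ≤ 1#
      h≤1 = *-cancelˡ-≤ 0<b (begin
        b * h                  ≈⟨ bh≈x-s² ⟩
        x - s * s              ≤⟨ ≤-by (0≤+ (0≤+ 0≤1 (0≤+ 0≤s 0≤s)) (0≤x² s))
                                    (solve 3 (λ x s e → (x :- s :* s) :+ ((e :+ (s :+ s)) :+ s :* s) := e :+ (s :+ s :+ x)) refl x s 1#) ⟩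
        b                      ≈⟨ *-identityʳ b ⟨
        b * 1#                 ∎)
      s+h≤s : s + h ≤ s
      s+h≤s = root-upper 1 (0≤+ 0≤s (<⇒≤ 0<h)) (begin
        (s + h) ^ 2                      ≈⟨ x^2≈x*x (s + h) ⟩
        (s + h) * (s + h)                ≈⟨ solve 2 (λ s h → (s :+ h) :* (s :+ h) := s :* s :+ h :* (h :+ (s :+ s))) refl s h ⟩
        s * s + h * (h + (s + s))        ≤⟨ +-mono-≤ ≤-refl (*-monoʳ-≤ (<⇒≤ 0<h) (+-mono-≤ h≤1 (x≤x+y 0≤x))) ⟩
        s * s + h * b                    ≈⟨ +-congˡ (trans (*-comm h b) bh≈x-s²) ⟩
        s * s + (x - s * s)              ≈⟨ solve 2 (λ x s → s :* s :+ (x :- s :* s) := x) refl x s ⟩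
        x                                ∎)

  √-cancel-≤ : ∀ {x y} → 0# ≤ x → 0# ≤ y → √ x ≤ √ y → x ≤ y
  √-cancel-≤ 0≤x 0≤y √x≤√y = ≤-respˡ (√-square 0≤x) (≤-respʳ (√-square 0≤y) (square-mono-≤ (0≤root 1 0≤x) √x≤√y))

  √-mono-≤ : ∀ {x y} → 0# ≤ x → x ≤ y → √ x ≤ √ y
  √-mono-≤ 0≤x x≤y = root-least 1 0≤x λ z 0≤z z²≤x → root-upper 1 0≤z (≤-trans z²≤x x≤y)

  √-< : ∀ {x y} → 0# ≤ x → 0# ≤ y → x < y * y → √ x < y
  √-< 0≤x 0≤y x<yy = ≰⇒> λ y≤√x → <⇒≱ x<yy (≤-respʳ (√-square 0≤x) (square-mono-≤ 0≤y y≤√x))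

-- Exponential growth in the natural numbers.

module ℕGrowth where
  open import Data.Nat.Base using (_+_; _*_; _^_; _≤_; _<_)
  open ℕ.≤-Reasoning

  ^-distribˡ-* : ∀ m n k → (m * n) ^ k ≡ m ^ k * n ^ k
  ^-distribˡ-* m n zero    = ≡.refl
  ^-distribˡ-* m n (suc k) = ≡.trans (≡.cong (m * n *_) (^-distribˡ-* m n k)) (ℕ.[m*n]*[o*p]≡[m*o]*[n*p] m n (m ^ k) (n ^ k))

  -- Bernoulli's inequality (1 + 1/m)^k ≥ 1 + k/m, cleared of denominators.
  bernoulli : ∀ m k → (m + k) * m ^ k ≤ m * suc m ^ k
  bernoulli m zero    = ℕ.≤-reflexive (≡.cong (_* 1) (ℕ.+-identityʳ m))
  bernoulli m (suc k) = begin
    (m + suc k) * (m * m ^ k)                    ≤⟨ ℕ.m≤m+n _ (k * m ^ k) ⟩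
    (m + suc k) * (m * m ^ k) + k * m ^ k        ≡⟨ eq m k (m ^ k) ⟩
    suc m * ((m + k) * m ^ k)                    ≤⟨ ℕ.*-monoʳ-≤ (suc m) (bernoulli m k) ⟩
    suc m * (m * suc m ^ k)                      ≡⟨ swap (suc m) m (suc m ^ k) ⟩
    m * suc m ^ suc k                            ∎
    where
    open ℕSolver.+-*-Solver
    eq : ∀ m k p → (m + suc k) * (m * p) + k * p ≡ suc m * ((m + k) * p)
    eq = solve 3 (λ m k p → (m :+ (con 1 :+ k)) :* (m :* p) :+ k :* p := (con 1 :+ m) :* ((m :+ k) :* p)) ≡.refl
    swap : ∀ a b c → a * (b * c) ≡ b * (a * c)
    swap = solve 3 (λ a b c → a :* (b :* c) := b :* (a :* c)) ≡.refl

  -- For k = m * c the number m * c * m ^ k is k * m ^ k, which lies below the left side of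
  -- `bernoulli`.
  ^-outgrows : ∀ {m n} .{{_ : ℕ.NonZero m}} c → m < n → ∃[ k ] c * m ^ k < n ^ k
  ^-outgrows {m} {n} c m<n = k , ℕ.<-≤-trans (ℕ.*-cancelˡ-< m _ _ (begin-strict
    m * (c * m ^ k)          ≡⟨ ℕ.*-assoc m c (m ^ k) ⟨
    k * m ^ k                <⟨ ℕ.m<n+m (k * m ^ k) (ℕ.>-nonZero⁻¹ (m * m ^ k) {{ℕ.m^n≢0 m (suc k)}}) ⟩
    m * m ^ k + k * m ^ k    ≡⟨ ℕ.*-distribʳ-+ (m ^ k) m k ⟨
    (m + k) * m ^ k          ≤⟨ bernoulli m k ⟩
    m * suc m ^ k            ∎)) (ℕ.^-monoˡ-≤ k m<n)
    where k = m * c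

-- Boxes, their cells, and the pigeonhole principle.

module Boxes (em : ExcludedMiddle 0ℓ) (ℝ : CompleteOrderedField) where
  open CompleteOrderedField ℝ hiding (zero)
  open OrderedField em ℝ

  Within : Carrier → Carrier → Set
  Within b x = - b ≤ x × x ≤ b

  Small : Carrier → Carrier → Set
  Small δ x = - δ < x × x < δ

  Small-0 : ∀ {δ x} → 0# < δ → x ≈ 0# → Small δ x
  Small-0 {δ} {x} 0<δ x≈0 =
    ≰⇒> (λ x≤-δ → <⇒≱ 0<δ (≤-by (0≤y-x x≤-δ) (trans (solve 2 (λ δ x → δ :+ (:- δ :- x) := :- x) refl δ x) (trans (-‿cong x≈0) ε⁻¹≈ε)))) ,
    ≤-<-trans (≤-reflexive x≈0) 0<δ

  Within-weaken : ∀ {b c x} → b ≤ c → Within b x → Within c x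
  Within-weaken b≤c (-b≤x , x≤b) = ≤-trans (neg-mono-≤ b≤c) -b≤x , ≤-trans x≤b b≤c

  Small-cong : ∀ {b x y} → x ≈ y → Small b x → Small b y
  Small-cong x≈y (-b<x , x<b) = <-≤-trans -b<x (≤-reflexive x≈y) , ≤-<-trans (≤-reflexive (sym x≈y)) x<b

  bounded : ∀ {n} (x : Fin n → Carrier) → ∃[ b ] 0# ≤ b × ∀ i → Within b (x i)
  bounded {zero} x = 0# , ≤-refl , λ ()
  bounded {suc n} x with bounded (x ∘ suc) | total 0# (x zero)
  ... | b , 0≤b , within | inj₁ 0≤x₀ = x zero + b , 0≤+ 0≤x₀ 0≤b , λ
    { zero    → ≤-by (0≤+ (0≤+ 0≤x₀ 0≤x₀) 0≤b) (solve 2 (λ x b → :- (x :+ b) :+ ((x :+ x) :+ b) := x) refl (x zero) b) , x≤x+y 0≤b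
    ; (suc i) → Within-weaken (≤-by 0≤x₀ (+-comm _ _)) (within i) }
  ... | b , 0≤b , within | inj₂ x₀≤0 = b - x zero , 0≤b-x₀ , λ
    { zero    → ≤-by 0≤b (solve 2 (λ x b → :- (b :- x) :+ b := x) refl (x zero) b) , ≤-trans x₀≤0 0≤b-x₀
    ; (suc i) → Within-weaken (≤-by (0≤y-x x₀≤0) (solve 2 (λ x b → b :+ (con (+ 0) :- x) := b :- x) refl (x zero) b)) (within i) }
    where
    0≤b-x₀ : 0# ≤ b - x zero
    0≤b-x₀ = 0≤y-x (≤-trans x₀≤0 0≤b)

  -- `m` is the floor of x/δ, found by searching downwards from the bound `n`.
  cell : ∀ {δ x} n → 0# ≤ x → x < fromℕ n * δ →
         ∃[ m ] m ℕ.< n × fromℕ m * δ ≤ x × x < fromℕ (suc m) * δ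
  cell {δ} zero 0≤x x<0 = contradiction 0≤x (<⇒≱ (<-≤-trans x<0 (≤-reflexive (zeroˡ δ))))
  cell {δ} {x} (suc n) 0≤x x<nδ with em {x < fromℕ n * δ}
  ... | no x≮  = n , ℕ.≤-refl , ≮⇒≥ x≮ , x<nδ
  ... | yes x< with cell n 0≤x x<
  ...   | m , m<n , lower , upper = m , ℕ.m≤n⇒m≤1+n m<n , lower , upper

  same-cell : ∀ {δ x y m} → fromℕ m * δ ≤ x → x < fromℕ (suc m) * δ →
              fromℕ m * δ ≤ y → y < fromℕ (suc m) * δ → Small δ (x - y)
  same-cell {δ} {x} {y} {m} mδ≤x x<mδ+δ mδ≤y y<mδ+δ =
    ≰⇒> (λ x-y≤-δ → <⇒≱ y<mδ+δ (≤-by (0≤+ (0≤y-x x-y≤-δ) (0≤y-x mδ≤x)) (trans (+-congʳ expand)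
      (solve 4 (λ p δ x y → (δ :+ p) :+ ((:- δ :- (x :- y)) :+ (x :- p)) := y) refl (fromℕ m * δ) δ x y)))) ,
    ≰⇒> (λ δ≤x-y → <⇒≱ x<mδ+δ (≤-by (0≤+ (0≤y-x δ≤x-y) (0≤y-x mδ≤y)) (trans (+-congʳ expand)
      (solve 4 (λ p δ x y → (δ :+ p) :+ (((x :- y) :- δ) :+ (y :- p)) := x) refl (fromℕ m * δ) δ x y))))
    where
    expand : fromℕ (suc m) * δ ≈ δ + fromℕ m * δ
    expand = trans (distribʳ δ 1# (fromℕ m)) (+-congʳ (*-identityˡ δ))

  -- Shifting by b moves the box to [0, 2b]^D, which fits into k^D cells of side δ; `funToFin`
  -- encodes the D cell indices of a point as one number below k^D, and two points share it.
  close-pair : ∀ {δ b} k D n → b + b < fromℕ k * δ → k ℕ.^ D ℕ.< n →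
               (x : Fin n → Fin D → Carrier) → (∀ i l → Within b (x i l)) →
               ∃₂ λ i j → i Fin.< j × ∀ l → Small δ (x i l - x j l)
  close-pair {δ} {b} k D n 2b<kδ kᴰ<n x within =
    let i , j , i<j , same = Fin.pigeonhole kᴰ<n (λ i → funToFin (cells i))
    in i , j , i<j , λ l → same-cells i j l (≡.trans (≡.sym (Fin.finToFun-funToFin (cells i) l))
         (≡.trans (≡.cong (λ c → finToFun c l) same) (Fin.finToFun-funToFin (cells j) l)))
    where
    cellOf : ∀ i l → ∃[ m ] m ℕ.< k × fromℕ m * δ ≤ x i l + b × x i l + b < fromℕ (suc m) * δ
    cellOf i l = cell k
      (≤-respˡ (-‿inverseˡ b) (+-monoˡ-≤ b (proj₁ (within i l))))
      (≤-<-trans (+-monoˡ-≤ b (proj₂ (within i l))) 2b<kδ)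
    cells : ∀ i → Fin D → Fin k
    cells i l = fromℕ< (proj₁ (proj₂ (cellOf i l)))
    same-cells : ∀ i j l → cells i l ≡ cells j l → Small δ (x i l - x j l)
    same-cells i j l same =
      let m , m<k , lower , upper = cellOf i l
          m′ , m′<k , lower′ , upper′ = cellOf j l
          m≡m′ = ≡.trans (≡.sym (Fin.toℕ-fromℕ< m<k)) (≡.trans (≡.cong toℕ same) (Fin.toℕ-fromℕ< m′<k))
      in Small-cong (solve 3 (λ x y b → (x :+ b) :- (y :+ b) := x :- y) refl (x i l) (x j l) b)
           (same-cell {m = m} lower upper
             (≡.subst (λ m → fromℕ m * δ ≤ x j l + b) (≡.sym m≡m′) lower′)
             (≡.subst (λ m → x j l + b < fromℕ (suc m) * δ) (≡.sym m≡m′) upper′))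

-- Congruence modulo doubles in a discrete group.

module Halving (em : ExcludedMiddle 0ℓ) (ℝ : CompleteOrderedField) (G : AbelianGroup 0ℓ 0ℓ) where
  open CompleteOrderedField ℝ using (Carrier; _+_; _*_; -_; _-_; 0#; _≤_; _<_; fromℕ)
  private module ℝ = CompleteOrderedField ℝ
  open OrderedField em ℝ
  open Boxes em ℝ
  open AbelianGroup G using (_∙_; ε; _⁻¹; _≈_; ∙-cong; ∙-congʳ; ∙-congˡ; ⁻¹-cong) renaming (Carrier to ∣G∣)
  private module G where
    open AbelianGroup G public
    open AbelianGroupProperties G public
    open CommutativeSemigroupProperties commutativeSemigroup public using (interchange)

  infix 4 _≡₂_
  _≡₂_ : ∣G∣ → ∣G∣ → Set
  x ≡₂ y = ∃[ g ] x ≈ y ∙ (g ∙ g)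

  difference-≡₂ : ∀ {x y v w} → x ∙ (v ∙ v) ≈ y ∙ (w ∙ w) → x ≡₂ y
  difference-≡₂ {x} {y} {v} {w} eq = w ∙ v ⁻¹ , (begin
    x                                        ≈⟨ G.//-rightDividesʳ (v ∙ v) x ⟨
    (x ∙ (v ∙ v)) ∙ (v ∙ v) ⁻¹               ≈⟨ ∙-cong eq (G.sym (G.⁻¹-∙-comm v v)) ⟩
    (y ∙ (w ∙ w)) ∙ (v ⁻¹ ∙ v ⁻¹)            ≈⟨ G.assoc y _ _ ⟩
    y ∙ ((w ∙ w) ∙ (v ⁻¹ ∙ v ⁻¹))            ≈⟨ ∙-congˡ (G.interchange w w (v ⁻¹) (v ⁻¹)) ⟩
    y ∙ ((w ∙ v ⁻¹) ∙ (w ∙ v ⁻¹))            ∎)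
    where open SetoidReasoning G.setoid

  ≡₂-sym : ∀ {x y} → x ≡₂ y → y ≡₂ x
  ≡₂-sym {x} (g , eq) = difference-≡₂ {v = g} {w = ε}
    (G.trans (G.sym eq) (G.sym (G.trans (∙-congˡ (G.identityˡ ε)) (G.identityʳ x))))

  ≡₂-cancelˡ : ∀ z {x y} → z ∙ x ≡₂ z ∙ y → x ≡₂ y
  ≡₂-cancelˡ z (g , eq) = g , G.∙-cancelˡ z _ _ (G.trans eq (G.assoc z _ _))

  ≡₂-respʳ : ∀ {x y z} → y ≈ z → x ≡₂ y → x ≡₂ z
  ≡₂-respʳ y≈z (g , eq) = g , G.trans eq (∙-congʳ y≈z)

  IsDouble : ∣G∣ → Set
  IsDouble x = ∃[ h ] x ≈ h ∙ h

  IsDouble-resp : ∀ {x y} → x ≈ y → IsDouble x → IsDouble y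
  IsDouble-resp x≈y (h , eq) = h , G.trans (G.sym x≈y) eq

  x≡₂x∙y⇒IsDouble : ∀ {x y} → x ≡₂ x ∙ y → IsDouble y
  x≡₂x∙y⇒IsDouble {x} {y} (g , eq) = g ⁻¹ , (begin
    y                               ≈⟨ G.//-rightDividesʳ (g ∙ g) y ⟨
    (y ∙ (g ∙ g)) ∙ (g ∙ g) ⁻¹      ≈⟨ ∙-cong ygg≈ε (G.sym (G.⁻¹-∙-comm g g)) ⟩
    ε ∙ (g ⁻¹ ∙ g ⁻¹)               ≈⟨ G.identityˡ _ ⟩
    g ⁻¹ ∙ g ⁻¹                     ∎)
    where
    open SetoidReasoning G.setoid
    ygg≈ε : y ∙ (g ∙ g) ≈ ε
    ygg≈ε = G.identityʳ-unique x _ (G.trans (G.sym (G.assoc x y _)) (G.sym eq))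

  x≡₂y∙z⇒IsDouble : ∀ {x y z} → x ≡₂ y ∙ z → IsDouble ((x ∙ y) ∙ z)
  x≡₂y∙z⇒IsDouble {x} {y} {z} (g , eq) = (y ∙ z) ∙ g , (begin
    (x ∙ y) ∙ z                         ≈⟨ G.assoc x y z ⟩
    x ∙ (y ∙ z)                         ≈⟨ ∙-congʳ eq ⟩
    ((y ∙ z) ∙ (g ∙ g)) ∙ (y ∙ z)       ≈⟨ G.assoc _ _ _ ⟩
    (y ∙ z) ∙ ((g ∙ g) ∙ (y ∙ z))       ≈⟨ ∙-congˡ (G.trans (G.comm _ _) (G.sym (G.assoc _ g g))) ⟩
    (y ∙ z) ∙ ((y ∙ z ∙ g) ∙ g)         ≈⟨ ∙-congˡ (G.comm _ g) ⟩
    (y ∙ z) ∙ (g ∙ (y ∙ z ∙ g))         ≈⟨ G.assoc _ g _ ⟨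
    (y ∙ z ∙ g) ∙ (y ∙ z ∙ g)           ∎)
    where open SetoidReasoning G.setoid

  x≡₂y∙y⇒IsDouble : ∀ {x y} → x ≡₂ y ∙ y → IsDouble x
  x≡₂y∙y⇒IsDouble {x} {y} (g , eq) = y ∙ g , G.trans eq (G.interchange y y g g)

  IsDouble-swapˡ : ∀ x y z → IsDouble ((x ∙ y) ∙ z) → IsDouble ((y ∙ x) ∙ z)
  IsDouble-swapˡ x y z = IsDouble-resp (∙-congʳ (G.comm x y))

  IsDouble-swapʳ : ∀ x y z → IsDouble ((x ∙ y) ∙ z) → IsDouble ((x ∙ z) ∙ y)
  IsDouble-swapʳ x y z = IsDouble-resp (G.trans (G.assoc x y z) (G.trans (∙-congˡ (G.comm y z)) (G.sym (G.assoc x z y))))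

  module Discrete {D : ℕ} (φ : ∣G∣ → Fin D → Carrier)
           (φ-cong : ∀ {x y} → x ≈ y → ∀ l → φ x l ℝ.≈ φ y l)
           (φ-∙ : ∀ x y l → φ (x ∙ y) l ℝ.≈ φ x l + φ y l)
           {δ : Carrier} (0<δ : 0# < δ)
           (discrete : ∀ x → (∀ l → Small δ (φ x l)) → x ≈ ε) where

    φ-ε : ∀ l → φ ε l ℝ.≈ 0#
    φ-ε l = ℝ.trans (solve 1 (λ a → a := (a :+ a) :- a) ℝ.refl (φ ε l))
      (ℝ.trans (ℝ.+-congʳ (ℝ.trans (ℝ.sym (φ-∙ ε ε l)) (φ-cong (G.identityˡ ε) l))) (ℝ.-‿inverseʳ _))

    φ-⁻¹ : ∀ x l → φ (x ⁻¹) l ℝ.≈ - φ x l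
    φ-⁻¹ x l = ℝ.trans (solve 2 (λ a b → a := (b :+ a) :- b) ℝ.refl (φ (x ⁻¹) l) (φ x l))
      (ℝ.trans (ℝ.+-congʳ (ℝ.trans (ℝ.sym (φ-∙ x (x ⁻¹) l)) (ℝ.trans (φ-cong (G.inverseʳ x) l) (φ-ε l)))) (ℝ.+-identityˡ _))

    torsion-free : ∀ x → x ∙ x ≈ ε → x ≈ ε
    torsion-free x xx≈ε = discrete x λ l → Small-0 0<δ (*-cancelˡ-≈ 0<2 (begin
      fromℕ 2 * φ x l     ≈⟨ solve 1 (λ a → :2 :* a := a :+ a) ℝ.refl (φ x l) ⟩
      φ x l + φ x l       ≈⟨ φ-∙ x x l ⟨
      φ (x ∙ x) l         ≈⟨ φ-cong xx≈ε l ⟩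
      φ ε l               ≈⟨ φ-ε l ⟩
      0#                  ≈⟨ ℝ.zeroʳ _ ⟨
      fromℕ 2 * 0#        ∎))
      where open SetoidReasoning ℝ.setoid

    separated : ∀ x y → (∀ l → Small δ (φ x l - φ y l)) → x ≈ y
    separated x y small = G.x∙y⁻¹≈ε⇒x≈y x y (discrete (x ∙ y ⁻¹) λ l →
      Small-cong (ℝ.sym (ℝ.trans (φ-∙ x (y ⁻¹) l) (ℝ.+-congˡ (φ-⁻¹ y l)))) (small l))

    module _ {n : ℕ} (x : Fin n → ∣G∣) where

      -- The element with binary expansion s, the x i serving as digits.
      expand : ∀ {k} → (Fin k → Fin n) → ∣G∣
      expand {zero}  s = ε
      expand {suc k} s = x (s zero) ∙ (expand (s ∘ suc) ∙ expand (s ∘ suc))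

      expand-bound : ∀ {b} → 0# ≤ b → (∀ i l → Within b (φ (x i) l)) →
                     ∀ {k} (s : Fin k → Fin n) l → Within (fromℕ (2 ℕ.^ k) * b) (φ (expand s) l)
      expand-bound {b} 0≤b within {k} s l =
        let lower , upper = strengthened s in
        ≤-by (0≤+ lower 0≤b) (solve 3 (λ p b v → :- (p :* b) :+ ((p :* b :+ v :- b) :+ b) := v) ℝ.refl (fromℕ (2 ℕ.^ k)) b (φ (expand s) l)) ,
        ≤-by (0≤+ upper 0≤b) (solve 3 (λ p b v → v :+ ((p :* b :- v :- b) :+ b) := p :* b) ℝ.refl (fromℕ (2 ℕ.^ k)) b (φ (expand s) l))
        where
        -- The induction closes for the bound (2^k - 1)b, since 2(2^k - 1)b + b = (2^(k+1) - 1)b;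
        -- with 2^k b it would not.
        strengthened : ∀ {k} (s : Fin k → Fin n) →
                       0# ≤ fromℕ (2 ℕ.^ k) * b + φ (expand s) l - b ×
                       0# ≤ fromℕ (2 ℕ.^ k) * b - φ (expand s) l - b
        strengthened {zero} s =
          ≤-reflexive (ℝ.sym (ℝ.trans (ℝ.+-congʳ (ℝ.+-congˡ (φ-ε l))) (solve 1 (λ b → con (+ 1) :* b :+ con (+ 0) :- b := con (+ 0)) ℝ.refl b))) ,
          ≤-reflexive (ℝ.sym (ℝ.trans (ℝ.+-congʳ (ℝ.+-congˡ (ℝ.-‿cong (φ-ε l)))) (solve 1 (λ b → con (+ 1) :* b :- con (+ 0) :- b := con (+ 0)) ℝ.refl b)))
        strengthened {suc k} s =
          let a = φ (x (s zero)) l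
              v = φ (expand (s ∘ suc)) l
              p = fromℕ (2 ℕ.^ k)
              lower , upper = strengthened (s ∘ suc)
              a-lower , a-upper = within (s zero) l
              φ-expand = ℝ.trans (φ-∙ (x (s zero)) _ l) (ℝ.+-congˡ (φ-∙ _ _ l))
              2p = ℝ.trans (fromℕ-+ (2 ℕ.^ k) _) (ℝ.+-congˡ (fromℕ-+ (2 ℕ.^ k) 0))
          in
          ≤-respʳ (ℝ.trans (solve 4 (λ a b v p → (((p :* b :+ v :- b) :+ (p :* b :+ v :- b)) :+ (a :- :- b))
                              := (p :+ (p :+ con (+ 0))) :* b :+ (a :+ (v :+ v)) :- b) ℝ.refl a b v p)
                    (ℝ.+-congʳ (ℝ.+-cong (ℝ.*-congʳ (ℝ.sym 2p)) (ℝ.sym φ-expand))))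
                  (0≤+ (0≤+ lower lower) (0≤y-x a-lower)) ,
          ≤-respʳ (ℝ.trans (solve 4 (λ a b v p → (((p :* b :- v :- b) :+ (p :* b :- v :- b)) :+ (b :- a))
                              := (p :+ (p :+ con (+ 0))) :* b :- (a :+ (v :+ v)) :- b) ℝ.refl a b v p)
                    (ℝ.+-congʳ (ℝ.+-cong (ℝ.*-congʳ (ℝ.sym 2p)) (ℝ.-‿cong (ℝ.sym φ-expand)))))
                  (0≤+ (0≤+ upper upper) (0≤y-x a-upper))

      -- The class of an expansion modulo doubles determines its first digit. Cancelling that digit
      -- leaves the doubles of the two tails, and torsion-freeness allows halving.
      expand-injective : (∀ i j → x i ≡₂ x j → i ≡ j) →
                         ∀ {k} (s t : Fin k → Fin n) → expand s ≈ expand t → ∀ l → s l ≡ t l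
      expand-injective distinct {suc k} s t eq = λ
        { zero    → s₀≡t₀
        ; (suc l) → expand-injective distinct (s ∘ suc) (t ∘ suc) tails l }
        where
        v = expand (s ∘ suc)
        w = expand (t ∘ suc)
        s₀≡t₀ : s zero ≡ t zero
        s₀≡t₀ = distinct _ _ (difference-≡₂ eq)
        vv≈ww : v ∙ v ≈ w ∙ w
        vv≈ww = G.∙-cancelˡ (x (s zero)) _ _ (G.trans eq (∙-congʳ (G.reflexive (≡.cong x (≡.sym s₀≡t₀)))))
        tails : v ≈ w
        tails = G.x∙y⁻¹≈ε⇒x≈y v w (torsion-free _ (begin
          (v ∙ w ⁻¹) ∙ (v ∙ w ⁻¹)   ≈⟨ G.interchange v (w ⁻¹) v (w ⁻¹) ⟩
          (v ∙ v) ∙ (w ⁻¹ ∙ w ⁻¹)   ≈⟨ ∙-cong vv≈ww (G.⁻¹-∙-comm w w) ⟩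
          (w ∙ w) ∙ (w ∙ w) ⁻¹      ≈⟨ G.inverseʳ _ ⟩
          ε                         ∎))
          where open SetoidReasoning G.setoid

      -- If the digits were pairwise incongruent, the n^k expansions of length k would be distinct
      -- points of a box of side O(2^k), which splits into O(2^{kD}) cells too small for two points.
      congruent-pair : 2 ℕ.^ D ℕ.< n → ∃₂ λ i j → i ≢ j × x i ≡₂ x j
      congruent-pair 2ᴰ<n with em {∃₂ λ i j → i ≢ j × x i ≡₂ x j}
      ... | yes found = found
      ... | no none = contradiction (≡.cong toℕ u≡v) (ℕ.<⇒≢ u<v)
        where
        distinct : ∀ i j → x i ≡₂ x j → i ≡ j
        distinct i j i≡₂j with i Fin.≟ j
        ... | yes i≡j = i≡j
        ... | no i≢j  = contradiction (i , j , i≢j , i≡₂j) none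
        bounds : ∀ i → ∃[ b ] 0# ≤ b × ∀ l → Within b (φ (x i) l)
        bounds i = bounded (φ (x i))
        bound : ∃[ b ] 0# ≤ b × ∀ i → Within b (proj₁ (bounds i))
        bound = bounded (proj₁ ∘ bounds)
        b = proj₁ bound
        0≤b = proj₁ (proj₂ bound)
        within : ∀ i l → Within b (φ (x i) l)
        within i l = Within-weaken (proj₂ (proj₂ (proj₂ bound) i)) (proj₂ (proj₂ (bounds i)) l)
        cells : ∃[ c ] b + b < fromℕ c * δ
        cells = archimedean (b + b) 0<δ
        c = proj₁ cells
        -- `c` is chosen before `k`: each side of the box of length k is cut into 2^k * c pieces, so
        -- the cells number c^D (2^D)^k, a fixed multiple of a power of 2^D.
        growth : ∃[ k ] c ℕ.^ D ℕ.* (2 ℕ.^ D) ℕ.^ k ℕ.< n ℕ.^ k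
        growth = ℕGrowth.^-outgrows {{ℕ.m^n≢0 2 D}} (c ℕ.^ D) 2ᴰ<n
        k = proj₁ growth
        p = fromℕ (2 ℕ.^ k)
        0<p : 0# < p
        0<p = <-≤-trans 0<1 (1≤fromℕ {2 ℕ.^ k} (ℕ.m^n>0 2 k))
        2pb<pcδ : p * b + p * b < fromℕ (2 ℕ.^ k ℕ.* c) * δ
        2pb<pcδ = ≰⇒> λ le → <⇒≱ (proj₂ cells) (*-cancelˡ-≤ 0<p
          (≤-respʳ (ℝ.sym (ℝ.distribˡ p b b)) (≤-respˡ (ℝ.trans (ℝ.*-congʳ (fromℕ-* (2 ℕ.^ k) c)) (ℝ.*-assoc _ _ _)) le)))
        count : (2 ℕ.^ k ℕ.* c) ℕ.^ D ℕ.< n ℕ.^ k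
        count = ≡.subst (ℕ._< n ℕ.^ k) (≡.sym (≡.trans (ℕGrowth.^-distribˡ-* (2 ℕ.^ k) c D)
          (≡.trans (ℕ.*-comm _ (c ℕ.^ D)) (≡.cong (c ℕ.^ D ℕ.*_)
            (≡.trans (ℕ.^-*-assoc 2 k D) (≡.trans (≡.cong (2 ℕ.^_) (ℕ.*-comm k D)) (≡.sym (ℕ.^-*-assoc 2 D k)))))))) (proj₂ growth)
        digits : Fin (n ℕ.^ k) → Fin k → Fin n
        digits = finToFun
        close = close-pair (2 ℕ.^ k ℕ.* c) D (n ℕ.^ k) 2pb<pcδ count (λ u → φ (expand (digits u)))
          (λ u → expand-bound 0≤b within (digits u))
        u = proj₁ close
        v = proj₁ (proj₂ close)
        u<v = proj₁ (proj₂ (proj₂ close))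
        same-digits : ∀ l → digits u l ≡ digits v l
        same-digits = expand-injective distinct (digits u) (digits v)
          (separated _ _ (proj₂ (proj₂ (proj₂ close))))
        funToFin-cong : ∀ {m n} {f g : Fin m → Fin n} → (∀ l → f l ≡ g l) → funToFin f ≡ funToFin g
        funToFin-cong {zero}  f≗g = ≡.refl
        funToFin-cong {suc m} f≗g = ≡.cong₂ Fin.combine (f≗g zero) (funToFin-cong (f≗g ∘ suc))
        u≡v : u ≡ v
        u≡v = ≡.trans (≡.sym (Fin.funToFin-finToFin {k} {n} u))
          (≡.trans (funToFin-cong same-digits) (Fin.funToFin-finToFin {k} {n} v))

-- Inner products, orthogonal projections and coordinates.

module InnerProducts (em : ExcludedMiddle 0ℓ) (ℝ : CompleteOrderedField) (V : InnerProductSpace ℝ) where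
  open CompleteOrderedField ℝ hiding (zero)
  open OrderedField em ℝ
  open Roots em ℝ using (divide; 0<factor)
  open Boxes em ℝ
  open InnerProductSpace V
  open AbelianGroupProperties +ᴹ-abelianGroup public
    using () renaming (//-rightDividesˡ to -ᴹ-+ᴹ-cancel; ⁻¹-∙-comm to -ᴹ‿+ᴹ-comm;
                       x∙y⁻¹≈ε⇒x≈y to x-y≈0⇒x≈y; ε⁻¹≈ε to -ᴹ0≈0)
  open CommutativeSemigroupProperties (AbelianGroup.commutativeSemigroup +ᴹ-abelianGroup) public
    using () renaming (interchange to +ᴹ-interchange)
  open SetoidReasoning setoid

  infixl 6 _-ᴹ_
  _-ᴹ_ : Carrierᴹ → Carrierᴹ → Carrierᴹ
  u -ᴹ v = u +ᴹ -ᴹ v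

  ⟨⟩-congˡ : ∀ {u v w} → u ≈ᴹ v → ⟨ u , w ⟩ ≈ ⟨ v , w ⟩
  ⟨⟩-congˡ u≈v = ⟨⟩-cong u≈v ≈ᴹ-refl

  ⟨⟩-congʳ : ∀ {u v w} → u ≈ᴹ v → ⟨ w , u ⟩ ≈ ⟨ w , v ⟩
  ⟨⟩-congʳ u≈v = ⟨⟩-cong ≈ᴹ-refl u≈v

  ⟨⟩-+ʳ : ∀ u v w → ⟨ u , v +ᴹ w ⟩ ≈ ⟨ u , v ⟩ + ⟨ u , w ⟩
  ⟨⟩-+ʳ u v w = trans (⟨⟩-sym u _) (trans (⟨⟩-+ v w u) (+-cong (⟨⟩-sym v u) (⟨⟩-sym w u)))

  ⟨⟩-*ₗʳ : ∀ c u v → ⟨ u , c *ₗ v ⟩ ≈ c * ⟨ u , v ⟩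
  ⟨⟩-*ₗʳ c u v = trans (⟨⟩-sym u _) (trans (⟨⟩-*ₗ c v u) (*-congˡ (⟨⟩-sym v u)))

  ⟨⟩-zeroˡ : ∀ v → ⟨ 0ᴹ , v ⟩ ≈ 0#
  ⟨⟩-zeroˡ v = trans (⟨⟩-congˡ (≈ᴹ-sym (*ₗ-zeroˡ 0ᴹ))) (trans (⟨⟩-*ₗ 0# 0ᴹ v) (zeroˡ _))

  ⟨⟩-negˡ : ∀ u v → ⟨ -ᴹ u , v ⟩ ≈ - ⟨ u , v ⟩
  ⟨⟩-negˡ u v = begin
    ⟨ -ᴹ u , v ⟩                              ≈⟨ solve 2 (λ a b → a := (a :+ b) :- b) refl ⟨ -ᴹ u , v ⟩ ⟨ u , v ⟩ ⟩
    (⟨ -ᴹ u , v ⟩ + ⟨ u , v ⟩) - ⟨ u , v ⟩    ≈⟨ +-congʳ (⟨⟩-+ _ _ _) ⟨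
    ⟨ -ᴹ u +ᴹ u , v ⟩ - ⟨ u , v ⟩             ≈⟨ +-congʳ (trans (⟨⟩-congˡ (-ᴹ‿inverseˡ u)) (⟨⟩-zeroˡ v)) ⟩
    0# - ⟨ u , v ⟩                            ≈⟨ +-identityˡ _ ⟩
    - ⟨ u , v ⟩                               ∎

  ⟨⟩-negʳ : ∀ u v → ⟨ u , -ᴹ v ⟩ ≈ - ⟨ u , v ⟩
  ⟨⟩-negʳ u v = trans (⟨⟩-sym u _) (trans (⟨⟩-negˡ v u) (-‿cong (⟨⟩-sym v u)))

  ⟨⟩-- : ∀ u v w → ⟨ u -ᴹ v , w ⟩ ≈ ⟨ u , w ⟩ - ⟨ v , w ⟩
  ⟨⟩-- u v w = trans (⟨⟩-+ u _ w) (+-congˡ (⟨⟩-negˡ v w))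

  infix 8 ‖_‖²
  -- Lengths are compared through their squares, so that every identity between them is polynomial.
  ‖_‖² : Carrierᴹ → Carrier
  ‖ v ‖² = ⟨ v , v ⟩

  ‖‖²-cong : ∀ {u v} → u ≈ᴹ v → ‖ u ‖² ≈ ‖ v ‖²
  ‖‖²-cong u≈v = ⟨⟩-cong u≈v u≈v

  ‖+‖² : ∀ u v → ‖ u +ᴹ v ‖² ≈ ‖ u ‖² + (⟨ u , v ⟩ + ⟨ u , v ⟩) + ‖ v ‖²
  ‖+‖² u v = begin
    ⟨ u +ᴹ v , u +ᴹ v ⟩                                  ≈⟨ ⟨⟩-+ u v _ ⟩
    ⟨ u , u +ᴹ v ⟩ + ⟨ v , u +ᴹ v ⟩                      ≈⟨ +-cong (⟨⟩-+ʳ u u v) (⟨⟩-+ʳ v u v) ⟩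
    (‖ u ‖² + ⟨ u , v ⟩) + (⟨ v , u ⟩ + ‖ v ‖²)          ≈⟨ +-congˡ (+-congʳ (⟨⟩-sym v u)) ⟩
    (‖ u ‖² + ⟨ u , v ⟩) + (⟨ u , v ⟩ + ‖ v ‖²)          ≈⟨ solve 3 (λ a b c → (a :+ b) :+ (b :+ c) := a :+ (b :+ b) :+ c) refl _ _ _ ⟩
    ‖ u ‖² + (⟨ u , v ⟩ + ⟨ u , v ⟩) + ‖ v ‖²            ∎

  ‖neg‖² : ∀ v → ‖ -ᴹ v ‖² ≈ ‖ v ‖²
  ‖neg‖² v = trans (⟨⟩-negˡ v _) (trans (-‿cong (⟨⟩-negʳ v v)) (⁻¹-involutive _))

  ‖-‖² : ∀ u v → ‖ u -ᴹ v ‖² ≈ ‖ u ‖² - (⟨ u , v ⟩ + ⟨ u , v ⟩) + ‖ v ‖²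
  ‖-‖² u v = trans (‖+‖² u (-ᴹ v)) (+-cong (+-congˡ (trans (+-cong (⟨⟩-negʳ u v) (⟨⟩-negʳ u v)) (⁻¹-∙-comm _ _))) (‖neg‖² v))

  parallelogram : ∀ u v → ‖ u +ᴹ v ‖² + ‖ u -ᴹ v ‖² ≈ (‖ u ‖² + ‖ v ‖²) + (‖ u ‖² + ‖ v ‖²)
  parallelogram u v = trans (+-cong (‖+‖² u v) (‖-‖² u v))
    (solve 3 (λ a b c → (a :+ (b :+ b) :+ c) :+ (a :- (b :+ b) :+ c) := (a :+ c) :+ (a :+ c)) refl _ _ _)

  ‖*ₗ‖² : ∀ c v → ‖ c *ₗ v ‖² ≈ c * c * ‖ v ‖²
  ‖*ₗ‖² c v = trans (⟨⟩-*ₗ c v _) (trans (*-congˡ (⟨⟩-*ₗʳ c v v)) (sym (*-assoc _ _ _)))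

  linearCombination-cong : ∀ {n} {c d : Vector Carrier n} (e : Vector Carrierᴹ n) →
    (∀ i → c i ≈ d i) → linearCombination c e ≈ᴹ linearCombination d e
  linearCombination-cong {zero}  e c≈d = ≈ᴹ-refl
  linearCombination-cong {suc n} e c≈d = +ᴹ-cong (*ₗ-congʳ (c≈d zero)) (linearCombination-cong (e ∘ suc) (c≈d ∘ suc))

  linearCombination-+ : ∀ {n} (c d : Vector Carrier n) (e : Vector Carrierᴹ n) →
    linearCombination (λ i → c i + d i) e ≈ᴹ linearCombination c e +ᴹ linearCombination d e
  linearCombination-+ {zero}  c d e = ≈ᴹ-sym (+ᴹ-identityˡ 0ᴹ)
  linearCombination-+ {suc n} c d e = ≈ᴹ-trans
    (+ᴹ-cong (*ₗ-distribʳ (e zero) (c zero) (d zero)) (linearCombination-+ (c ∘ suc) (d ∘ suc) (e ∘ suc)))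
    (+ᴹ-interchange _ _ _ _)

  linearCombination-* : ∀ {n} k (c : Vector Carrier n) (e : Vector Carrierᴹ n) →
    linearCombination (λ i → k * c i) e ≈ᴹ k *ₗ linearCombination c e
  linearCombination-* {zero}  k c e = ≈ᴹ-sym (*ₗ-zeroʳ k)
  linearCombination-* {suc n} k c e = ≈ᴹ-trans
    (+ᴹ-cong (*ₗ-assoc k (c zero) (e zero)) (linearCombination-* k (c ∘ suc) (e ∘ suc)))
    (≈ᴹ-sym (*ₗ-distribˡ k _ _))

  -- A projection kept in this form shows its coefficients as inner products, hence as functionals
  -- bounded in terms of the norm.
  finiteRank : ∀ {n} (f e : Vector Carrierᴹ n) → Carrierᴹ → Carrierᴹ
  finiteRank f e v = linearCombination (λ i → ⟨ v , f i ⟩) e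

  module _ {n} (f e : Vector Carrierᴹ n) where
    finiteRank-cong : ∀ {u v} → u ≈ᴹ v → finiteRank f e u ≈ᴹ finiteRank f e v
    finiteRank-cong u≈v = linearCombination-cong e (λ i → ⟨⟩-congˡ u≈v)

    finiteRank-+ : ∀ u v → finiteRank f e (u +ᴹ v) ≈ᴹ finiteRank f e u +ᴹ finiteRank f e v
    finiteRank-+ u v = ≈ᴹ-trans (linearCombination-cong e (λ i → ⟨⟩-+ u v (f i))) (linearCombination-+ _ _ e)

    finiteRank-*ₗ : ∀ c v → finiteRank f e (c *ₗ v) ≈ᴹ c *ₗ finiteRank f e v
    finiteRank-*ₗ c v = ≈ᴹ-trans (linearCombination-cong e (λ i → ⟨⟩-*ₗ c v (f i))) (linearCombination-* c _ e)

    finiteRank-0 : finiteRank f e 0ᴹ ≈ᴹ 0ᴹ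
    finiteRank-0 = ≈ᴹ-trans (finiteRank-cong (≈ᴹ-sym (*ₗ-zeroˡ 0ᴹ))) (≈ᴹ-trans (finiteRank-*ₗ 0# 0ᴹ) (*ₗ-zeroˡ _))

    finiteRank-fixes-span : ∀ {m} (b : Vector Carrierᴹ m) → (∀ i → finiteRank f e (b i) ≈ᴹ b i) →
      ∀ c → finiteRank f e (linearCombination c b) ≈ᴹ linearCombination c b
    finiteRank-fixes-span {zero}  b fixes c = finiteRank-0
    finiteRank-fixes-span {suc m} b fixes c = ≈ᴹ-trans (finiteRank-+ _ _)
      (+ᴹ-cong (≈ᴹ-trans (finiteRank-*ₗ _ _) (*ₗ-congˡ (fixes zero))) (finiteRank-fixes-span (b ∘ suc) (fixes ∘ suc) (c ∘ suc)))

  -- Self-adjointness and idempotence are what the inductive construction uses to see that a new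
  -- direction is orthogonal to the previous range.
  record OrthogonalProjection {n} (b : Vector Carrierᴹ n) : Set where
    field
      functional direction : Vector Carrierᴹ n
    project : Carrierᴹ → Carrierᴹ
    project = finiteRank functional direction
    field
      self-adjoint : ∀ u v → ⟨ project u , v ⟩ ≈ ⟨ u , project v ⟩
      idempotent   : ∀ v → project (project v) ≈ᴹ project v
      fixes        : ∀ i → project (b i) ≈ᴹ b i

  -- c is 1/‖w‖² for nonzero w and 0 otherwise; the equation covers both cases, so Gram-Schmidt
  -- passes uniformly over vectors that depend on the others.
  normalise : ∀ w → ∃[ c ] (c * ‖ w ‖²) *ₗ w ≈ᴹ w
  normalise w with em {‖ w ‖² ≈ 0#}
  ... | yes ww≈0 = 0# , ≈ᴹ-trans (*ₗ-congˡ w≈0) (≈ᴹ-trans (*ₗ-zeroʳ _) (≈ᴹ-sym w≈0))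
    where
    w≈0 : w ≈ᴹ 0ᴹ
    w≈0 = ⟨⟩-definite w ww≈0
  ... | no ww≉0 with inverse ‖ w ‖² ww≉0
  ...   | c , ww*c≈1 = c , ≈ᴹ-trans (*ₗ-congʳ (trans (*-comm c _) ww*c≈1)) (*ₗ-identityˡ w)

  -- One Gram-Schmidt step: for w = b₀ - P b₀ the new projection is v ↦ c⟨v, w⟩w + P v. Here P w = 0
  -- by idempotence, and self-adjointness turns this into orthogonality of w to the range of P.
  orthogonalProjection : ∀ {n} (b : Vector Carrierᴹ n) → OrthogonalProjection b
  orthogonalProjection {zero} b = record
    { functional = λ () ; direction = λ ()
    ; self-adjoint = λ u v → trans (⟨⟩-zeroˡ v) (sym (trans (⟨⟩-sym u 0ᴹ) (⟨⟩-zeroˡ u)))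
    ; idempotent = λ v → ≈ᴹ-refl
    ; fixes = λ () }
  orthogonalProjection {suc n} b = record
    { functional = f′ ; direction = e′
    ; self-adjoint = λ u v → begin
        ⟨ ⟨ u , c *ₗ w ⟩ *ₗ w +ᴹ P u , v ⟩            ≈⟨ trans (⟨⟩-+ _ _ v) (+-congʳ (⟨⟩-*ₗ _ w v)) ⟩
        ⟨ u , c *ₗ w ⟩ * ⟨ w , v ⟩ + ⟨ P u , v ⟩      ≈⟨ +-cong (*-cong (⟨⟩-*ₗʳ c u w) (⟨⟩-sym w v)) (self-adjoint u v) ⟩
        (c * ⟨ u , w ⟩) * ⟨ v , w ⟩ + ⟨ u , P v ⟩     ≈⟨ +-congʳ (solve 3 (λ c a b → (c :* a) :* b := (c :* b) :* a) refl _ _ _) ⟩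
        (c * ⟨ v , w ⟩) * ⟨ u , w ⟩ + ⟨ u , P v ⟩     ≈⟨ +-congʳ (*-congʳ (⟨⟩-*ₗʳ c v w)) ⟨
        ⟨ v , c *ₗ w ⟩ * ⟨ u , w ⟩ + ⟨ u , P v ⟩      ≈⟨ trans (⟨⟩-+ʳ u _ _) (+-congʳ (⟨⟩-*ₗʳ _ u w)) ⟨
        ⟨ u , ⟨ v , c *ₗ w ⟩ *ₗ w +ᴹ P v ⟩            ∎
    ; idempotent = λ v → let k = ⟨ v , c *ₗ w ⟩ in +ᴹ-cong
        (≈ᴹ-trans (*ₗ-congʳ (begin
            ⟨ k *ₗ w +ᴹ P v , c *ₗ w ⟩               ≈⟨ trans (⟨⟩-*ₗʳ c _ w) (*-congˡ (⟨⟩-+ _ _ w)) ⟩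
            c * (⟨ k *ₗ w , w ⟩ + ⟨ P v , w ⟩)       ≈⟨ *-congˡ (+-cong (⟨⟩-*ₗ k w w) (P⊥w v)) ⟩
            c * (k * ‖ w ‖² + 0#)                    ≈⟨ solve 3 (λ c k s → c :* (k :* s :+ con (+ 0)) := k :* (c :* s)) refl c k ‖ w ‖² ⟩
            k * (c * ‖ w ‖²)                         ∎))
          (≈ᴹ-trans (*ₗ-assoc k _ w) (*ₗ-congˡ cww≈w)))
        (≈ᴹ-trans (finiteRank-+ f e _ _) (≈ᴹ-trans (+ᴹ-cong
          (≈ᴹ-trans (finiteRank-*ₗ f e k w) (≈ᴹ-trans (*ₗ-congˡ Pw≈0) (*ₗ-zeroʳ k))) (idempotent v)) (+ᴹ-identityˡ _)))
    ; fixes = λ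
        { zero → ≈ᴹ-trans (+ᴹ-congʳ (≈ᴹ-trans (*ₗ-congʳ (begin
            ⟨ b zero , c *ₗ w ⟩                         ≈⟨ ⟨⟩-*ₗʳ c _ w ⟩
            c * ⟨ b zero , w ⟩                          ≈⟨ *-congˡ (trans (⟨⟩-congˡ (≈ᴹ-sym (-ᴹ-+ᴹ-cancel (P (b zero)) (b zero)))) (⟨⟩-+ w _ w)) ⟩
            c * (‖ w ‖² + ⟨ P (b zero) , w ⟩)           ≈⟨ *-congˡ (trans (+-congˡ (P⊥w (b zero))) (+-identityʳ _)) ⟩
            c * ‖ w ‖²                                  ∎)) cww≈w)) (-ᴹ-+ᴹ-cancel (P (b zero)) (b zero))
        ; (suc i) → ≈ᴹ-trans (+ᴹ-cong (≈ᴹ-trans (*ₗ-congʳ (begin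
            ⟨ b (suc i) , c *ₗ w ⟩                      ≈⟨ ⟨⟩-*ₗʳ c _ w ⟩
            c * ⟨ b (suc i) , w ⟩                       ≈⟨ *-congˡ (trans (⟨⟩-congˡ (≈ᴹ-sym (fixes i))) (P⊥w _)) ⟩
            c * 0#                                      ≈⟨ zeroʳ c ⟩
            0#                                          ∎)) (*ₗ-zeroˡ w)) (fixes i)) (+ᴹ-identityˡ _) } }
    where
    open OrthogonalProjection (orthogonalProjection (b ∘ suc))
      renaming (functional to f; direction to e; project to P)
    w : Carrierᴹ
    w = b zero -ᴹ P (b zero)
    c : Carrier
    c = proj₁ (normalise w)
    cww≈w : (c * ‖ w ‖²) *ₗ w ≈ᴹ w
    cww≈w = proj₂ (normalise w)
    f′ e′ : Vector Carrierᴹ (suc n)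
    f′ zero    = c *ₗ w
    f′ (suc i) = f i
    e′ zero    = w
    e′ (suc i) = e i
    Pw+PPb≈PPb : P w +ᴹ P (P (b zero)) ≈ᴹ P (P (b zero))
    Pw+PPb≈PPb = ≈ᴹ-trans (≈ᴹ-sym (finiteRank-+ f e _ _))
      (≈ᴹ-trans (finiteRank-cong f e (-ᴹ-+ᴹ-cancel (P (b zero)) (b zero))) (≈ᴹ-sym (idempotent _)))
    Pw≈0 : P w ≈ᴹ 0ᴹ
    Pw≈0 = AbelianGroupProperties.identityˡ-unique +ᴹ-abelianGroup _ _ Pw+PPb≈PPb
    P⊥w : ∀ v → ⟨ P v , w ⟩ ≈ 0#
    P⊥w v = trans (self-adjoint v w) (trans (⟨⟩-congʳ Pw≈0) (trans (⟨⟩-sym v 0ᴹ) (⟨⟩-zeroˡ v)))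

  -- Unlike the basis coordinates, the coordinates ⟨ v , f i ⟩ are evidently bounded by the norm of v.
  IsExpansion : ∀ {n} (f e : Vector Carrierᴹ n) → Set
  IsExpansion f e = ∀ v → v ≈ᴹ finiteRank f e v

  -- The projection attached to a basis fixes the basis, so it is the identity and its coefficients
  -- are coordinates.
  coordinates : ∀ {d} → HasDimension d → Σ (Vector Carrierᴹ d) λ f → ∃ (IsExpansion f)
  coordinates (b , _ , spans) = functional , direction , λ v →
    let c , v≈cb = spans v in
    ≈ᴹ-sym (≈ᴹ-trans (finiteRank-cong functional direction v≈cb)
      (≈ᴹ-trans (finiteRank-fixes-span functional direction b fixes c) (≈ᴹ-sym v≈cb)))
    where open OrthogonalProjection (orthogonalProjection b)

  -- Nonnegativity of ‖v + f‖² and ‖v - f‖² bounds 2⟨v, f⟩ from both sides by ‖v‖² + ‖f‖², a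
  -- root-free relative of Cauchy-Schwarz.
  ⟨⟩-bound : ∀ {R} v f → ‖ v ‖² ≤ R → Within (R + ‖ f ‖²) ⟨ v , f ⟩
  ⟨⟩-bound {R} v f vv≤R =
    halve (≤-respʳ (trans (+-congʳ (+-congʳ (‖+‖² v f)))
      (solve 4 (λ a x c R → (a :+ (x :+ x) :+ c) :+ (R :- a) :+ (R :+ c) := (x :- :- (R :+ c)) :+ (x :- :- (R :+ c))) refl ‖ v ‖² ⟨ v , f ⟩ ‖ f ‖² R))
      (0≤+ (0≤+ (⟨⟩-nonNeg (v +ᴹ f)) (0≤y-x vv≤R)) 0≤R+ff)) ,
    halve (≤-respʳ (trans (+-congʳ (+-congʳ (‖-‖² v f)))
      (solve 4 (λ a x c R → (a :- (x :+ x) :+ c) :+ (R :- a) :+ (R :+ c) := ((R :+ c) :- x) :+ ((R :+ c) :- x)) refl ‖ v ‖² ⟨ v , f ⟩ ‖ f ‖² R))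
      (0≤+ (0≤+ (⟨⟩-nonNeg (v -ᴹ f)) (0≤y-x vv≤R)) 0≤R+ff))
    where
    0≤R+ff : 0# ≤ R + ‖ f ‖²
    0≤R+ff = 0≤+ (≤-trans (⟨⟩-nonNeg v) vv≤R) (⟨⟩-nonNeg f)
    halve : ∀ {x y} → 0# ≤ (y - x) + (y - x) → x ≤ y
    halve {x} {y} le = *-cancelˡ-≤ 0<2 (≤-by le (solve 2 (λ x y → :2 :* x :+ ((y :- x) :+ (y :- x)) := :2 :* y) refl x y))

  -- By ‖u + v‖² ≤ 2‖u‖² + 2‖v‖², one vector at a time. C depends on `e` alone, so a cell size can
  -- be fixed before the coefficients are known.
  linearCombination-bound : ∀ {n} (e : Vector Carrierᴹ n) → ∃[ C ] 0# ≤ C ×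
    (∀ c t → 0# ≤ t → (∀ i → c i * c i ≤ t) → ‖ linearCombination c e ‖² ≤ t * C)
  linearCombination-bound {zero} e = 0# , ≤-refl , λ c t 0≤t _ → ≤-reflexive (trans (⟨⟩-zeroˡ 0ᴹ) (sym (zeroʳ t)))
  linearCombination-bound {suc n} e with linearCombination-bound (e ∘ suc)
  ... | C , 0≤C , bound = fromℕ 2 * (‖ e zero ‖² + C) , *-nonNeg (0≤fromℕ 2) (0≤+ (⟨⟩-nonNeg _) 0≤C) , λ c t 0≤t cc≤t →
    let u = c zero *ₗ e zero
        v = linearCombination (c ∘ suc) (e ∘ suc)
        uu≤ = ≤-respˡ (sym (‖*ₗ‖² _ _)) (*-mono-≤ (0≤x² (c zero)) (⟨⟩-nonNeg (e zero)) (cc≤t zero) ≤-refl)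
        vv≤ = bound (c ∘ suc) t 0≤t (cc≤t ∘ suc)
    in ≤-trans (≤-by (⟨⟩-nonNeg (u -ᴹ v)) (parallelogram u v)) (≤-trans (+-mono-≤ (+-mono-≤ uu≤ vv≤) (+-mono-≤ uu≤ vv≤))
         (≤-reflexive (solve 3 (λ t a C → (t :* a :+ t :* C) :+ (t :* a :+ t :* C) := t :* (:2 :* (a :+ C))) refl t ‖ e zero ‖² C)))

  Small⇒square : ∀ {δ x} → Small δ x → x * x ≤ δ * δ
  Small⇒square {δ} {x} (-δ<x , x<δ) = ≤-by (*-nonNeg (0≤y-x (<⇒≤ -δ<x)) (0≤y-x (<⇒≤ x<δ)))
    (solve 2 (λ δ x → x :* x :+ (x :- :- δ) :* (δ :- x) := δ :* δ) refl δ x)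

  small-coordinates : ∀ {n} (e : Vector Carrierᴹ n) {ε} → 0# < ε → ∃[ δ ] 0# < δ ×
    (∀ c → (∀ i → Small δ (c i)) → ‖ linearCombination c e ‖² < ε * ε)
  small-coordinates e {ε} 0<ε with linearCombination-bound e
  ... | C , 0≤C , bound = δ , 0<δ , λ c small →
    ≤-<-trans (bound c (δ * δ) (0≤x² δ) (Small⇒square ∘ small)) δδC<εε
    where
    -- Dividing ε by 1 + C gives ε² = (1 + C)²δ² > Cδ² without taking a root of C.
    T : Carrier
    T = 1# + C
    0<T : 0# < T
    0<T = 0<x+y 0<1 0≤C
    δ : Carrier
    δ = proj₁ (divide ε 0<T)
    Tδ≈ε : T * δ ≈ ε
    Tδ≈ε = proj₂ (divide ε 0<T)
    0<δ : 0# < δ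
    0<δ = 0<factor 0<T Tδ≈ε 0<ε
    δδC<εε : δ * δ * C < ε * ε
    δδC<εε = ≰⇒> λ εε≤δδC → <⇒≱ (0<x*y 0<δ 0<δ) (≤-by
      (0≤+ (0≤y-x εε≤δδC) (*-nonNeg (0≤x² δ) (*-nonNeg 0≤C (<⇒≤ 0<T))))
      (trans (+-congˡ (+-congʳ (+-congˡ (-‿cong (*-cong (sym Tδ≈ε) (sym Tδ≈ε))))))
        (trans (solve 3 (λ e C δ → δ :* δ :+ (δ :* δ :* C :- ((e :+ C) :* δ) :* ((e :+ C) :* δ) :+ δ :* δ :* (C :* (e :+ C)))
                    := δ :* δ :+ δ :* δ :* C :- e :* (δ :* δ :* (e :+ C))) refl 1# C δ)
          (trans (+-congˡ (-‿cong (trans (*-identityˡ _) (trans (distribˡ _ _ _) (+-congʳ (*-identityʳ _)))))) (-‿inverseʳ _)))))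

  -- The parallelogram law for b + g and g, whose sum is a and whose difference is b, with the term
  -- 2‖b + g‖² dropped.
  halving-bound : ∀ {a b g} → a ≈ᴹ b +ᴹ (g +ᴹ g) → ‖ g ‖² + ‖ g ‖² ≤ ‖ a ‖² + ‖ b ‖²
  halving-bound {a} {b} {g} a≈b+2g = ≤-by (0≤+ (⟨⟩-nonNeg (b +ᴹ g)) (⟨⟩-nonNeg (b +ᴹ g))) (begin
    (G + G) + (‖ b +ᴹ g ‖² + ‖ b +ᴹ g ‖²)            ≈⟨ +-congˡ (+-cong (‖+‖² b g) (‖+‖² b g)) ⟩
    (G + G) + ((B + (x + x) + G) + (B + (x + x) + G)) ≈⟨ solve 3 (λ B x G → (G :+ G) :+ ((B :+ (x :+ x) :+ G) :+ (B :+ (x :+ x) :+ G))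
                                                          := (B :+ ((x :+ x) :+ (x :+ x)) :+ (G :+ (G :+ G) :+ G)) :+ B) refl B x G ⟩
    (B + ((x + x) + (x + x)) + (G + (G + G) + G)) + B ≈⟨ +-congʳ (+-cong (+-congˡ (+-cong (⟨⟩-+ʳ b g g) (⟨⟩-+ʳ b g g))) (‖+‖² g g)) ⟨
    (B + (⟨ b , g +ᴹ g ⟩ + ⟨ b , g +ᴹ g ⟩) + ‖ g +ᴹ g ‖²) + B ≈⟨ +-congʳ (trans (‖‖²-cong a≈b+2g) (‖+‖² b (g +ᴹ g))) ⟨
    ‖ a ‖² + B                                        ∎)
    where
    G B x : Carrier
    G = ‖ g ‖²
    B = ‖ b ‖²
    x = ⟨ b , g ⟩

  -- The sum of the squared distances from η is ‖a‖² + ‖b‖² + ‖c‖² - ‖η‖².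
  midpoint-bound : ∀ {a b c η} → (a +ᴹ b) +ᴹ c ≈ᴹ η +ᴹ η →
                   ‖ η -ᴹ c ‖² + ‖ η -ᴹ b ‖² + ‖ η -ᴹ a ‖² ≤ ‖ a ‖² + ‖ b ‖² + ‖ c ‖²
  midpoint-bound {a} {b} {c} {η} a+b+c≈2η = ≤-by (⟨⟩-nonNeg η) (begin
    ‖ η -ᴹ c ‖² + ‖ η -ᴹ b ‖² + ‖ η -ᴹ a ‖² + H          ≈⟨ +-congʳ (+-cong (+-cong (‖-‖² η c) (‖-‖² η b)) (‖-‖² η a)) ⟩
    (H - (z + z) + C) + (H - (y + y) + B) + (H - (x + x) + A) + H
      ≈⟨ solve 7 (λ H x y z A B C → (H :- (z :+ z) :+ C) :+ (H :- (y :+ y) :+ B) :+ (H :- (x :+ x) :+ A) :+ H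
           := (A :+ B :+ C) :+ (((H :+ H) :- (x :+ y :+ z)) :+ ((H :+ H) :- (x :+ y :+ z)))) refl H x y z A B C ⟩
    (A + B + C) + ((H + H - (x + y + z)) + (H + H - (x + y + z))) ≈⟨ +-congˡ (+-cong zero-term zero-term) ⟩
    (A + B + C) + (0# + 0#)                              ≈⟨ trans (+-congˡ (+-identityˡ 0#)) (+-identityʳ _) ⟩
    A + B + C                                            ∎)
    where
    A B C H x y z : Carrier
    A = ‖ a ‖²
    B = ‖ b ‖²
    C = ‖ c ‖²
    H = ‖ η ‖²
    x = ⟨ η , a ⟩
    y = ⟨ η , b ⟩
    z = ⟨ η , c ⟩
    zero-term : H + H - (x + y + z) ≈ 0#
    zero-term = trans (+-congʳ (begin
      H + H                      ≈⟨ ⟨⟩-+ʳ η η η ⟨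
      ⟨ η , η +ᴹ η ⟩             ≈⟨ ⟨⟩-congʳ a+b+c≈2η ⟨
      ⟨ η , (a +ᴹ b) +ᴹ c ⟩      ≈⟨ trans (⟨⟩-+ʳ η _ c) (+-congʳ (⟨⟩-+ʳ η a b)) ⟩
      x + y + z                  ∎)) (-‿inverseʳ _)

-- Lattices: separation, nearest points, and classes of ℤ × L modulo doubles.

module Lattices (em : ExcludedMiddle 0ℓ) (ℝ : CompleteOrderedField) (V : InnerProductSpace ℝ)
                {L : Pred (InnerProductSpace.Carrierᴹ V) 0ℓ}
                (lattice : Approximation.IsFullRankLattice em ℝ V L)
                {d : ℕ} (f e : Vector (InnerProductSpace.Carrierᴹ V) d)
                (expansion : InnerProducts.IsExpansion em ℝ V f e) where
  open CompleteOrderedField ℝ hiding (zero)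
  open OrderedField em ℝ
  open Roots em ℝ
  open Boxes em ℝ
  open InnerProductSpace V
  open InnerProducts em ℝ V
  open Approximation em ℝ V
  open IsFullRankLattice lattice

  -ᴹ0 : ∀ v → v -ᴹ 0ᴹ ≈ᴹ v
  -ᴹ0 v = ≈ᴹ-trans (+ᴹ-congˡ -ᴹ0≈0) (+ᴹ-identityʳ v)

  Separates : Carrier → Set
  Separates δ = 0# < δ × (∀ v → v ∈ L → (∀ i → Small δ ⟨ v , f i ⟩) → v ≈ᴹ 0ᴹ)

  -- Discreteness at 0, carried over from the norm to the coordinates in which boxes are counted.
  separation : ∃ Separates
  separation = δ , 0<δ , λ v v∈L small → isolated v v∈L (norm<ε v (norm-small (λ i → ⟨ v , f i ⟩) small))
    where
    ε : Carrier
    ε = proj₁ (discrete 0ᴹ 0-closed)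
    0<ε : 0# < ε
    0<ε = proj₁ (proj₂ (discrete 0ᴹ 0-closed))
    isolated : ∀ v → v ∈ L → ‖ v -ᴹ 0ᴹ ‖ < ε → v ≈ᴹ 0ᴹ
    isolated = proj₂ (proj₂ (discrete 0ᴹ 0-closed))
    δ : Carrier
    δ = proj₁ (small-coordinates e 0<ε)
    0<δ : 0# < δ
    0<δ = proj₁ (proj₂ (small-coordinates e 0<ε))
    norm-small : ∀ c → (∀ i → Small δ (c i)) → ‖ linearCombination c e ‖² < ε * ε
    norm-small = proj₂ (proj₂ (small-coordinates e 0<ε))
    norm<ε : ∀ v → ‖ finiteRank f e v ‖² < ε * ε → ‖ v -ᴹ 0ᴹ ‖ < ε
    norm<ε v less = √-< {⟨ v -ᴹ 0ᴹ , v -ᴹ 0ᴹ ⟩} {ε} (⟨⟩-nonNeg (v -ᴹ 0ᴹ)) (<⇒≤ 0<ε)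
      (≤-<-trans (≤-reflexive (‖‖²-cong {v -ᴹ 0ᴹ} {finiteRank f e v} (≈ᴹ-trans (-ᴹ0 v) (expansion v)))) less)

  Nearest : Carrierᴹ → Set
  Nearest t = ∃[ p ] p ∈ L × (∀ p′ → p′ ∈ L → ‖ t -ᴹ p ‖² ≤ ‖ t -ᴹ p′ ‖²)

  -- If every lattice point has a closer one, iteration yields infinitely many distinct lattice
  -- points at bounded distance from `t`; two of them share a cell so small that they coincide.
  module Descent (t : Carrierᴹ) (no-nearest : ¬ Nearest t) where
    closer : ∀ p → p ∈ L → ∃[ p′ ] p′ ∈ L × ‖ t -ᴹ p′ ‖² < ‖ t -ᴹ p ‖²
    closer p p∈L with em {∃[ p′ ] p′ ∈ L × ‖ t -ᴹ p′ ‖² < ‖ t -ᴹ p ‖²}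
    ... | yes found = found
    ... | no none = contradiction (p , p∈L , λ p′ p′∈L → ≮⇒≥ λ less → none (p′ , p′∈L , less)) no-nearest

    descent : ℕ → Σ Carrierᴹ L
    descent zero    = 0ᴹ , 0-closed
    descent (suc k) = let p , p∈L = descent k ; p′ , p′∈L , _ = closer p p∈L in p′ , p′∈L

    point : ℕ → Carrierᴹ
    point k = proj₁ (descent k)

    distance : ℕ → Carrier
    distance k = ‖ t -ᴹ point k ‖²

    distance-step : ∀ k → distance (suc k) < distance k
    distance-step k = proj₂ (proj₂ (closer (point k) (proj₂ (descent k))))

    distance-antitone : ∀ {i j} → i ℕ.≤′ j → distance j ≤ distance i
    distance-antitone ℕ.≤′-refl           = ≤-refl
    distance-antitone (ℕ.≤′-step {k} i≤k) = ≤-trans (<⇒≤ (distance-step k)) (distance-antitone i≤k)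

    distance-decreasing : ∀ {i j} → i ℕ.< j → distance j < distance i
    distance-decreasing {i} i<j = ≤-<-trans (distance-antitone (ℕ.≤⇒≤′ i<j)) (distance-step i)

    difference : ∀ u v i → ⟨ t -ᴹ u , f i ⟩ - ⟨ t -ᴹ v , f i ⟩ ≈ ⟨ v -ᴹ u , f i ⟩
    difference u v i = trans (+-cong (⟨⟩-- t u (f i)) (-‿cong (⟨⟩-- t v (f i))))
      (trans (solve 3 (λ t a b → (t :- a) :- (t :- b) := b :- a) refl ⟨ t , f i ⟩ ⟨ u , f i ⟩ ⟨ v , f i ⟩) (sym (⟨⟩-- v u (f i))))

    no-collision : ∀ {δ} → Separates δ → ∀ i j → i ℕ.< j →
                   ¬ ∀ l → Small δ (⟨ t -ᴹ point i , f l ⟩ - ⟨ t -ᴹ point j , f l ⟩)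
    no-collision (_ , separates) i j i<j small = proj₂ (distance-decreasing i<j) (‖‖²-cong (+ᴹ-congˡ (-ᴹ‿cong pⱼ≈pᵢ)))
      where
      pⱼ≈pᵢ : point j ≈ᴹ point i
      pⱼ≈pᵢ = x-y≈0⇒x≈y (point j) (point i) (separates _
        (+-closed (proj₂ (descent j)) (neg-closed (proj₂ (descent i))))
        λ l → Small-cong (difference (point i) (point j) l) (small l))

    coordinates-bounded : ∃[ b ] ∀ k l → Within b ⟨ t -ᴹ point k , f l ⟩
    coordinates-bounded = let b , _ , bounds = bounded (λ i → distance 0 + ‖ f i ‖²) in
      b , λ k l → Within-weaken (proj₂ (bounds l)) (⟨⟩-bound (t -ᴹ point k) (f l) (distance-antitone (ℕ.≤⇒≤′ (z≤n {k}))))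

    collision : ∀ {δ b} → 0# < δ → (∀ k l → Within b ⟨ t -ᴹ point k , f l ⟩) →
                ∃₂ λ i j → i ℕ.< j × ∀ l → Small δ (⟨ t -ᴹ point i , f l ⟩ - ⟨ t -ᴹ point j , f l ⟩)
    collision {δ} {b} 0<δ within =
      let k , 2b<kδ = archimedean (b + b) 0<δ
          i , j , i<j , small = close-pair k d (suc (k ℕ.^ d)) 2b<kδ ℕ.≤-refl
                                  (λ i l → ⟨ t -ᴹ point (toℕ i) , f l ⟩) (λ i → within (toℕ i))
      in toℕ i , toℕ j , i<j , small

    impossible : ∃ Separates → ⊥
    impossible (δ , separates) =
      let i , j , i<j , small = collision (proj₁ separates) (proj₂ coordinates-bounded)
      in no-collision separates i j i<j small

  -- Makes ρ attained at denominators between consecutive terms of the sequence, about which the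
  -- definition of the sequence gives no witness.
  nearest : ∀ t → Nearest t
  nearest t with em {Nearest t}
  ... | yes found = found
  ... | no none   = ⊥-elim (Descent.impossible t none separation)

  latticeGroup : AbelianGroup 0ℓ 0ℓ
  latticeGroup = record
    { Carrier = Σ Carrierᴹ L
    ; _≈_ = λ u v → proj₁ u ≈ᴹ proj₁ v
    ; _∙_ = λ (u , u∈L) (v , v∈L) → u +ᴹ v , +-closed u∈L v∈L
    ; ε = 0ᴹ , 0-closed
    ; _⁻¹ = λ (u , u∈L) → -ᴹ u , neg-closed u∈L
    ; isAbelianGroup = record
      { isGroup = record
        { isMonoid = record
          { isSemigroup = record
            { isMagma = record
              { isEquivalence = record { refl = ≈ᴹ-refl ; sym = ≈ᴹ-sym ; trans = ≈ᴹ-trans }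
              ; ∙-cong = +ᴹ-cong }
            ; assoc = λ u v w → +ᴹ-assoc _ _ _ }
          ; identity = (λ u → +ᴹ-identityˡ _) , (λ u → +ᴹ-identityʳ _) }
        ; inverse = (λ u → -ᴹ‿inverseˡ _) , (λ u → -ᴹ‿inverseʳ _)
        ; ⁻¹-cong = -ᴹ‿cong }
      ; comm = λ u v → +ᴹ-comm _ _ } }

  ℤ×L : AbelianGroup 0ℓ 0ℓ
  ℤ×L = DirectProduct.abelianGroup ℤ.+-0-abelianGroup latticeGroup

  open AbelianGroup ℤ×L using () renaming (Carrier to Λ; _∙_ to _∙_; _≈_ to _≈Λ_; ε to εΛ)
  open Halving em ℝ ℤ×L public

  φ : Λ → Fin (suc d) → Carrier
  φ (z , v , _) zero    = fromℤ z
  φ (z , v , _) (suc i) = ⟨ v , f i ⟩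

  fromℤ-discrete : ∀ {δ} → δ ≤ 1# → ∀ z → Small δ (fromℤ z) → z ≡ + 0
  fromℤ-discrete δ≤1 (+ zero)  _ = ≡.refl
  fromℤ-discrete δ≤1 (+ suc n) (_ , z<δ) = contradiction (≤-trans δ≤1 (1≤fromℕ {suc n} (s≤s z≤n))) (<⇒≱ z<δ)
  fromℤ-discrete δ≤1 -[1+ n ]  (-δ<z , _) = contradiction (neg-mono-≤ (≤-trans δ≤1 (1≤fromℕ {suc n} (s≤s z≤n)))) (<⇒≱ -δ<z)

  Small-weaken : ∀ {δ ε x} → δ ≤ ε → Small δ x → Small ε x
  Small-weaken δ≤ε (-δ<x , x<δ) = ≤-<-trans (neg-mono-≤ δ≤ε) -δ<x , <-≤-trans x<δ δ≤ε

  -- With δ ≤ 1 the same cell size also separates the integers in the first factor of ℤ × L.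
  weaken-separation : ∃ Separates → ∃[ δ ] Separates δ × δ ≤ 1#
  weaken-separation (δ , separates) with total δ 1#
  ... | inj₁ δ≤1 = δ , separates , δ≤1
  ... | inj₂ 1≤δ = 1# , (0<1 , λ v v∈L small → proj₂ separates v v∈L (λ i → Small-weaken 1≤δ (small i))) , ≤-refl

  ℤ×L-discrete : ∀ {δ} → Separates δ → δ ≤ 1# → ∀ x → (∀ l → Small δ (φ x l)) → x ≈Λ εΛ
  ℤ×L-discrete (_ , separates) δ≤1 (z , v , v∈L) small =
    fromℤ-discrete δ≤1 z (small zero) , separates v v∈L (λ i → small (suc i))

  φ-cong : ∀ {x y} → x ≈Λ y → ∀ l → φ x l ≈ φ y l
  φ-cong {x} {y} (z≡ , _)   zero    = reflexive (≡.cong fromℤ z≡)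
  φ-cong {x} {y} (_ , u≈v) (suc i) = ⟨⟩-congˡ u≈v

  φ-+ : ∀ x y l → φ (x ∙ y) l ≈ φ x l + φ y l
  φ-+ (y , _) (z , _) zero           = fromℤ-+ y z
  φ-+ (_ , u , _) (_ , v , _) (suc i) = ⟨⟩-+ u v (f i)

  -- The embedding has one coordinate for ℤ and d for L, whence the threshold 2^(d+1).
  congruent-pairΛ : ∀ {n} (x : Fin n → Λ) → 2 ℕ.^ suc d ℕ.< n → ∃₂ λ i j → i ≢ j × x i ≡₂ x j
  congruent-pairΛ x =
    let δ , separates , δ≤1 = weaken-separation separation
    in Discrete.congruent-pair φ (λ {x} {y} → φ-cong {x} {y}) φ-+ (proj₁ separates) (ℤ×L-discrete separates δ≤1) x

-- Best approximation vectors and their residuals.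

private module ℤS = ℤSolver.+-*-Solver

-- Here |z| = |a - b|/2. The conclusion is the range of denominators in which `bestΛ` bounds
-- residuals from below.
half-bounds : ∀ z {a b Q} → + a ≡ + b ℤ.+ (z ℤ.+ z) → a ≢ b →
              a ℕ.< b ℕ.+ (Q ℕ.+ Q) → b ℕ.< a ℕ.+ (Q ℕ.+ Q) → 1 ℕ.≤ ℤ.∣ z ∣ × ℤ.∣ z ∣ ℕ.< Q
half-bounds (+ zero) {a} {b} eq a≢b _ _ = contradiction (≡.trans (ℤ.+-injective eq) (ℕ.+-identityʳ b)) a≢b
half-bounds (+ suc k) {a} {b} {Q} eq a≢b a<b+2Q _ = s≤s z≤n , ℕ.≰⇒> λ Q≤k →
  ℕ.<⇒≱ a<b+2Q (≡.subst (b ℕ.+ (Q ℕ.+ Q) ℕ.≤_) (≡.sym (ℤ.+-injective eq)) (ℕ.+-monoʳ-≤ b (ℕ.+-mono-≤ Q≤k Q≤k)))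
half-bounds -[1+ k ] {a} {b} {Q} eq a≢b _ b<a+2Q = s≤s z≤n , ℕ.≰⇒> λ Q≤k →
  ℕ.<⇒≱ b<a+2Q (≡.subst (a ℕ.+ (Q ℕ.+ Q) ℕ.≤_) (ℤ.+-injective eq′) (ℕ.+-monoʳ-≤ a (ℕ.+-mono-≤ Q≤k Q≤k)))
  where
  w : ℤ
  w = + suc k
  eq′ : + (a ℕ.+ (suc k ℕ.+ suc k)) ≡ + b
  eq′ = ≡.trans (≡.cong (ℤ._+ (w ℤ.+ w)) eq)
    (ℤS.solve 2 (λ b w → (b ℤS.:+ (ℤS.:- w ℤS.:+ ℤS.:- w)) ℤS.:+ (w ℤS.:+ w) ℤS.:= b) ≡.refl (+ b) w)

module BestApproximations
  (em : ExcludedMiddle 0ℓ) (ℝ : CompleteOrderedField) (V : InnerProductSpace ℝ)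
  {L : Pred (InnerProductSpace.Carrierᴹ V) 0ℓ}
  (lattice : Approximation.IsFullRankLattice em ℝ V L)
  {d : ℕ} (f e : Vector (InnerProductSpace.Carrierᴹ V) d)
  (expansion : InnerProducts.IsExpansion em ℝ V f e)
  {α : InnerProductSpace.Carrierᴹ V} {q : ℕ → ℕ}
  (sequence : Approximation.IsBestApproximationSequence em ℝ V L α q) where

  open CompleteOrderedField ℝ hiding (zero)
  open RealFunctions em ℝ
  open OrderedField em ℝ
  open Roots em ℝ
  open InnerProductSpace V
  open InnerProducts em ℝ V
  open Approximation em ℝ V
  open IsFullRankLattice lattice
  open IsBestApproximationSequence sequence
  open Lattices em ℝ V lattice f e expansion
  open AbelianGroup ℤ×L using () renaming (Carrier to Λ; _∙_ to _∙_; _≈_ to _≈Λ_; ε to εΛ; _⁻¹ to invΛ)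

  q<q : ∀ n → q n ℕ.< q (suc n)
  q<q n = proj₁ (proj₁ (next n))

  q-mono : ∀ {i j} → i ℕ.≤ j → q i ℕ.≤ q j
  q-mono {i} i≤j = go (ℕ.≤⇒≤′ i≤j)
    where
    go : ∀ {j} → i ℕ.≤′ j → q i ℕ.≤ q j
    go ℕ.≤′-refl         = ℕ.≤-refl
    go (ℕ.≤′-step {k} i≤j) = ℕ.≤-trans (go i≤j) (ℕ.<⇒≤ (q<q k))

  q-strict : ∀ {i j} → i ℕ.< j → q i ℕ.< q j
  q-strict {i} i<j = ℕ.<-≤-trans (q<q i) (q-mono i<j)

  1≤q : ∀ n → 1 ℕ.≤ q n
  1≤q n = ≡.subst (ℕ._≤ q n) first (q-mono {0} {n} z≤n)

  -- The improvement leading from `q n` to `q (suc n)` records a minimiser for `q n`; this is where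
  -- infinitude of the sequence supplies the vector `p n`.
  attained : ∀ n → ∃ (Isρ L α (q n))
  attained n = let _ , _ , r₀ , _ , isρ₀ , _ = proj₁ (next n) in r₀ , isρ₀

  p : ℕ → Carrierᴹ
  p n = proj₁ (proj₁ (proj₂ (attained n)))

  p∈L : ∀ n → p n ∈ L
  p∈L n = proj₁ (proj₂ (proj₁ (proj₂ (attained n))))

  m : ℕ → Λ
  m n = + q n , p n , p∈L n

  residual : Λ → Carrierᴹ
  residual (z , v , _) = fromℤ z *ₗ α -ᴹ v

  E : ℕ → Carrier
  E n = ‖ residual (m n) ‖²

  E-minimal : ∀ n v → v ∈ L → E n ≤ ‖ fromℕ (q n) *ₗ α -ᴹ v ‖²
  E-minimal n v v∈L = let r₀ , (p₀ , _ , r₀≈) , least = attained n in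
    √-cancel-≤ {E n} {‖ fromℕ (q n) *ₗ α -ᴹ v ‖²} (⟨⟩-nonNeg _) (⟨⟩-nonNeg _)
      (≤-respˡ r₀≈ (least ‖ fromℕ (q n) *ₗ α -ᴹ v ‖ (v , v∈L , refl)))

  E-step : ∀ n → E (suc n) < E n
  E-step n =
    -- `p′` stems from the step into `q (suc n)`, whereas `p (suc n)` stems from the step out of it;
    -- `E-minimal` compares the two.
    let _ , r , r₀ , ((p′ , p′∈L , r≈) , _) , ((_ , _ , r₀≈) , _) , r<r₀ = proj₁ (next n)
        E′ = ‖ fromℕ (q (suc n)) *ₗ α -ᴹ p′ ‖²
    in ≤-<-trans (E-minimal (suc n) p′ p′∈L) (≰⇒> λ E≤E′ →
         <⇒≱ r<r₀ (≤-respˡ (sym r₀≈) (≤-respʳ (sym r≈) (√-mono-≤ {E n} {E′} (⟨⟩-nonNeg _) E≤E′))))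

  E-antitone : ∀ {i j} → i ℕ.≤ j → E j ≤ E i
  E-antitone {i} i≤j = go (ℕ.≤⇒≤′ i≤j)
    where
    go : ∀ {j} → i ℕ.≤′ j → E j ≤ E i
    go ℕ.≤′-refl           = ≤-refl
    go (ℕ.≤′-step {k} i≤j) = ≤-trans (<⇒≤ (E-step k)) (go i≤j)

  E-strict : ∀ {i j} → i ℕ.< j → E j < E i
  E-strict {i} i<j = ≤-<-trans (E-antitone i<j) (E-step i)

  0<E : ∀ n → 0# < E n
  0<E n = ≤-<-trans (⟨⟩-nonNeg _) (E-step n)

  -- If the nearest lattice point did better than E j, then k would improve on `q j` before
  -- `q (suc j)`, against minimality of the latter.
  between : ∀ j k → q j ℕ.< k → k ℕ.< q (suc j) → ∀ v → v ∈ L → E j ≤ ‖ fromℕ k *ₗ α -ᴹ v ‖²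
  between j k qⱼ<k k<qⱼ₊₁ v v∈L =
    let w , w∈L , w-least = nearest (fromℕ k *ₗ α)
        r₀ , isρ₀ = attained j
        ww = ‖ fromℕ k *ₗ α -ᴹ w ‖²
        isρ : Isρ L α k (√ ww)
        isρ = (w , w∈L , refl) , λ { r (v′ , v′∈L , r≈) → ≤-respʳ (sym r≈)
                (√-mono-≤ {ww} {‖ fromℕ k *ₗ α -ᴹ v′ ‖²} (⟨⟩-nonNeg _) (w-least v′ v′∈L)) }
    in ≤-trans (≮⇒≥ {ww} {E j} λ ww<E → ℕ.<⇒≱ k<qⱼ₊₁ (proj₂ (next j) k
         (qⱼ<k , √ ww , r₀ , isρ , isρ₀ , ≰⇒> λ r₀≤√ww → <⇒≱ ww<E
           (√-cancel-≤ {E j} {ww} (⟨⟩-nonNeg _) (⟨⟩-nonNeg _) (≤-respˡ (proj₂ (proj₂ (proj₁ isρ₀))) r₀≤√ww)))))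
       (w-least v v∈L)

  best : ∀ j k → 1 ℕ.≤ k → k ℕ.< q (suc j) → ∀ v → v ∈ L → E j ≤ ‖ fromℕ k *ₗ α -ᴹ v ‖²
  best j k 1≤k k<q v v∈L with ℕ.<-cmp k (q j)
  best j k 1≤k k<q v v∈L       | tri≈ _ ≡.refl _ = E-minimal j v v∈L
  best j k 1≤k k<q v v∈L       | tri> _ _ q<k    = between j k q<k k<q v v∈L
  best zero k 1≤k k<q v v∈L    | tri< k<q₀ _ _   = contradiction (≡.subst (k ℕ.<_) first k<q₀) (ℕ.≤⇒≯ 1≤k)
  best (suc j) k 1≤k k<q v v∈L | tri< k<qⱼ _ _   = ≤-trans (<⇒≤ (E-step j)) (best j k 1≤k k<qⱼ v v∈L)

  residual-cong : ∀ x y → x ≈Λ y → residual x ≈ᴹ residual y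
  residual-cong (z , _) (z′ , _) (z≡z′ , u≈v) = +ᴹ-cong (*ₗ-congʳ (reflexive (≡.cong fromℤ z≡z′))) (-ᴹ‿cong u≈v)

  residual-∙ : ∀ x y → residual (x ∙ y) ≈ᴹ residual x +ᴹ residual y
  residual-∙ (y , u , _) (z , v , _) = ≈ᴹ-trans
    (+ᴹ-cong (≈ᴹ-trans (*ₗ-congʳ (fromℤ-+ y z)) (*ₗ-distribʳ α (fromℤ y) (fromℤ z))) (≈ᴹ-sym (-ᴹ‿+ᴹ-comm u v)))
    (+ᴹ-interchange _ _ _ _)

  residual-⁻¹ : ∀ x → residual (invΛ x) ≈ᴹ -ᴹ residual x
  residual-⁻¹ x = AbelianGroupProperties.inverseˡ-unique +ᴹ-abelianGroup _ _
    (≈ᴹ-trans (≈ᴹ-sym (residual-∙ (invΛ x) x))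
      (≈ᴹ-trans (residual-cong (invΛ x ∙ x) εΛ (AbelianGroup.inverseˡ ℤ×L x))
        (≈ᴹ-trans (+ᴹ-cong (*ₗ-zeroˡ α) -ᴹ0≈0) (+ᴹ-identityˡ 0ᴹ))))

  bestΛ : ∀ j x → 1 ℕ.≤ ℤ.∣ proj₁ x ∣ → ℤ.∣ proj₁ x ∣ ℕ.< q (suc j) → E j ≤ ‖ residual x ‖²
  bestΛ j (+ k , v , v∈L) 1≤z z<q = best j k 1≤z z<q v v∈L
  bestΛ j x@(-[1+ k ] , v , v∈L) 1≤z z<q = ≤-respʳ (trans (‖‖²-cong (residual-⁻¹ x)) (‖neg‖² (residual x)))
    (best j (suc k) 1≤z z<q (-ᴹ v) (neg-closed v∈L))

  -- Congruences among best approximation vectors in a narrow window.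

  module Window (n N : ℕ) (narrow : q N ℕ.< q (suc n) ℕ.+ q (suc n)) where

    Q : ℕ
    Q = q (suc n)

    q<x+2Q : ∀ {i} x → i ℕ.≤ N → q i ℕ.< x ℕ.+ (Q ℕ.+ Q)
    q<x+2Q x i≤N = ℕ.<-≤-trans (ℕ.≤-<-trans (q-mono i≤N) narrow) (ℕ.m≤n+m (Q ℕ.+ Q) x)

    residual-double : ∀ {x y g} → x ≈Λ y ∙ (g ∙ g) → residual x ≈ᴹ residual y +ᴹ (residual g +ᴹ residual g)
    residual-double {x} {y} {g} eq = ≈ᴹ-trans (residual-cong x (y ∙ (g ∙ g)) eq)
      (≈ᴹ-trans (residual-∙ y (g ∙ g)) (+ᴹ-congˡ (residual-∙ g g)))

    congruent-residuals : ∀ {i j} → q i ≢ q j → i ℕ.≤ N → j ℕ.≤ N → m i ≡₂ m j → E n + E n ≤ E i + E j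
    congruent-residuals {i} {j} qᵢ≢qⱼ i≤N j≤N (g , eq) =
      let 1≤z , z<Q = half-bounds (proj₁ g) (proj₁ eq) qᵢ≢qⱼ (q<x+2Q (q j) i≤N) (q<x+2Q (q i) j≤N)
          E≤ = bestΛ n g 1≤z z<Q
      in ≤-trans (+-mono-≤ E≤ E≤) (halving-bound (residual-double {m i} {m j} {g} eq))

    incongruent-< : ∀ {i j} → n ℕ.≤ i → i ℕ.< j → j ℕ.≤ N → ¬ m i ≡₂ m j
    incongruent-< {i} {j} n≤i i<j j≤N congruent =
      <⇒≱ (E-strict (ℕ.≤-<-trans n≤i i<j)) (≤-by (0≤+ (0≤y-x 2E≤) (0≤y-x (E-antitone n≤i)))
        (solve 3 (λ a b c → a :+ ((b :+ c :- (a :+ a)) :+ (a :- b)) := c) refl (E n) (E i) (E j)))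
      where
      2E≤ : E n + E n ≤ E i + E j
      2E≤ = congruent-residuals (ℕ.<⇒≢ (q-strict i<j)) (ℕ.≤-trans (ℕ.<⇒≤ i<j) j≤N) j≤N congruent

    incongruent : ∀ {i j} → n ℕ.≤ i → i ℕ.≤ N → n ℕ.≤ j → j ℕ.≤ N → i ≢ j → ¬ m i ≡₂ m j
    incongruent {i} {j} n≤i i≤N n≤j j≤N i≢j congruent with ℕ.<-cmp i j
    ... | tri≈ _ i≡j _ = i≢j i≡j
    ... | tri< i<j _ _ = incongruent-< n≤i i<j j≤N congruent
    ... | tri> _ _ j<i = incongruent-< n≤j j<i i≤N (≡₂-sym {m i} {m j} congruent)

    -- Half of `m j` would have a positive denominator below `q j`, hence squared residual at least
    -- E j, while halving leaves at most E j / 2. This disposes of collisions with coinciding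
    -- indices.
    not-double : ∀ j → ¬ IsDouble (m j)
    not-double j (h , eq) =
      let 1≤z , z<q = half-bounds (proj₁ h) {q j} {0} {q j} (≡.trans (proj₁ eq) (≡.sym (ℤ.+-identityˡ _)))
                        (ℕ.>⇒≢ (1≤q j)) (ℕ.m<m+n (q j) (1≤q j)) (ℕ.≤-trans (1≤q j) (ℕ.m≤m+n (q j) _))
          E≤ = bestΛ j h 1≤z (ℕ.<-trans z<q (q<q j))
          m≈2h = ≈ᴹ-trans (residual-cong (m j) (h ∙ h) eq) (≈ᴹ-trans (residual-∙ h h) (≈ᴹ-sym (+ᴹ-identityˡ _)))
      in <⇒≱ (0<E j) (≤-by (0≤y-x (≤-trans (+-mono-≤ E≤ E≤) (halving-bound {residual (m j)} {0ᴹ} {residual h} m≈2h)))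
           (trans (+-congˡ (+-congʳ (+-congˡ (⟨⟩-zeroˡ 0ᴹ)))) (solve 1 (λ a → a :+ ((a :+ con (+ 0)) :- (a :+ a)) := con (+ 0)) refl (E j))))

    -- The denominator z - c of h - m_c is half of a + b - c, written in the shape that
    -- `half-bounds` expects.
    half-complement : ∀ a b c z → (a ℤ.+ b) ℤ.+ c ≡ z ℤ.+ z → a ℤ.+ b ≡ c ℤ.+ ((z ℤ.+ ℤ.- c) ℤ.+ (z ℤ.+ ℤ.- c))
    half-complement a b c z eq = ≡.trans
      (ℤS.solve 3 (λ a b c → a ℤS.:+ b ℤS.:= c ℤS.:+ (((a ℤS.:+ b) ℤS.:+ c) ℤS.:+ (ℤS.:- c ℤS.:+ ℤS.:- c))) ≡.refl a b c)
      (≡.trans (≡.cong (λ s → c ℤ.+ (s ℤ.+ (ℤ.- c ℤ.+ ℤ.- c))) eq)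
        (ℤS.solve 2 (λ c z → c ℤS.:+ ((z ℤS.:+ z) ℤS.:+ (ℤS.:- c ℤS.:+ ℤS.:- c))
                            ℤS.:= c ℤS.:+ ((z ℤS.:+ ℤS.:- c) ℤS.:+ (z ℤS.:+ ℤS.:- c))) ≡.refl c z))

    residual-minus : ∀ x y → residual (x ∙ invΛ y) ≈ᴹ residual x -ᴹ residual y
    residual-minus x y = ≈ᴹ-trans (residual-∙ x (invΛ y)) (+ᴹ-congˡ (residual-⁻¹ y))

    -- If 2h is the sum, the denominators of h - m_k, h - m_j are below q_{n+1} and that of h - m_i is
    -- below q_k, so the squared residuals are at least E n, E n and E (k - 1).
    triple : ∀ {i j k} → n ℕ.≤ i → i ℕ.< j → j ℕ.< k → k ℕ.≤ N → IsDouble ((m i ∙ m j) ∙ m k) → q i ℕ.+ q j ≡ q k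
    triple {i} {j} {suc k} n≤i i<j j<k k≤N (h , eq) with q i ℕ.+ q j ℕ.≟ q (suc k)
    ... | yes found = found
    -- The failure of the equation says precisely that h - m_k has nonzero denominator; for the
    -- other two differences this follows from the order of the indices.
    ... | no qᵢ+qⱼ≢qₖ = contradiction absurd (<⇒≱ (E-step k))
      where
      z : ℤ
      z = proj₁ h
      i≤N : i ℕ.≤ N
      i≤N = ℕ.≤-trans (ℕ.<⇒≤ (ℕ.<-trans i<j j<k)) k≤N
      j≤N : j ℕ.≤ N
      j≤N = ℕ.≤-trans (ℕ.<⇒≤ j<k) k≤N
      qᵢ<qⱼ : q i ℕ.< q j
      qᵢ<qⱼ = q-strict i<j
      qⱼ<qₖ : q j ℕ.< q (suc k)
      qⱼ<qₖ = q-strict j<k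
      far : ∀ {l y} → E l ≤ ‖ residual (h ∙ invΛ y) ‖² → E l ≤ ‖ residual h -ᴹ residual y ‖²
      far {y = y} = ≤-respʳ (‖‖²-cong (residual-minus h y))
      a+c+b : (+ q i ℤ.+ + q (suc k)) ℤ.+ + q j ≡ z ℤ.+ z
      a+c+b = ≡.trans (ℤS.solve 3 (λ a b c → (a ℤS.:+ c) ℤS.:+ b ℤS.:= (a ℤS.:+ b) ℤS.:+ c) ≡.refl (+ q i) (+ q j) (+ q (suc k))) (proj₁ eq)
      b+c+a : (+ q j ℤ.+ + q (suc k)) ℤ.+ + q i ≡ z ℤ.+ z
      b+c+a = ≡.trans (ℤS.solve 3 (λ a b c → (b ℤS.:+ c) ℤS.:+ a ℤS.:= (a ℤS.:+ b) ℤS.:+ c) ≡.refl (+ q i) (+ q j) (+ q (suc k))) (proj₁ eq)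
      far-k : E n ≤ ‖ residual h -ᴹ residual (m (suc k)) ‖²
      far-k = let 1≤z , z<Q = half-bounds (z ℤ.+ ℤ.- + q (suc k)) (half-complement (+ q i) (+ q j) (+ q (suc k)) z (proj₁ eq)) qᵢ+qⱼ≢qₖ
                                (ℕ.+-mono-< (ℕ.<-trans qᵢ<qⱼ qⱼ<qₖ) (q<x+2Q 0 j≤N)) (q<x+2Q (q i ℕ.+ q j) k≤N)
              in far {n} {m (suc k)} (bestΛ n (h ∙ invΛ (m (suc k))) 1≤z z<Q)
      far-j : E n ≤ ‖ residual h -ᴹ residual (m j) ‖²
      far-j = let 1≤z , z<Q = half-bounds (z ℤ.+ ℤ.- + q j) {q i ℕ.+ q (suc k)} (half-complement (+ q i) (+ q (suc k)) (+ q j) z a+c+b)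
                                (ℕ.>⇒≢ (ℕ.<-≤-trans qⱼ<qₖ (ℕ.m≤n+m _ (q i))))
                                (ℕ.+-mono-< qᵢ<qⱼ (q<x+2Q 0 k≤N)) (q<x+2Q (q i ℕ.+ q (suc k)) j≤N)
              in far {n} {m j} (bestΛ n (h ∙ invΛ (m j)) 1≤z z<Q)
      far-i : E k ≤ ‖ residual h -ᴹ residual (m i) ‖²
      far-i = let 1≤z , z<q = half-bounds (z ℤ.+ ℤ.- + q i) {q j ℕ.+ q (suc k)} (half-complement (+ q j) (+ q (suc k)) (+ q i) z b+c+a)
                                (ℕ.>⇒≢ (ℕ.<-≤-trans qᵢ<qⱼ (ℕ.m≤m+n (q j) _)))
                                (ℕ.<-≤-trans (ℕ.+-monoˡ-< (q (suc k)) qⱼ<qₖ) (ℕ.m≤n+m _ (q i)))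
                                (ℕ.<-≤-trans (ℕ.<-trans qᵢ<qⱼ (ℕ.m<m+n (q j) (1≤q (suc k)))) (ℕ.m≤m+n _ _))
              in far {k} {m i} (bestΛ k (h ∙ invΛ (m i)) 1≤z z<q)
      sum≈2h : (residual (m i) +ᴹ residual (m j)) +ᴹ residual (m (suc k)) ≈ᴹ residual h +ᴹ residual h
      sum≈2h = ≈ᴹ-trans (+ᴹ-congʳ (≈ᴹ-sym (residual-∙ (m i) (m j)))) (≈ᴹ-trans (≈ᴹ-sym (residual-∙ (m i ∙ m j) (m (suc k))))
        (≈ᴹ-trans (residual-cong ((m i ∙ m j) ∙ m (suc k)) (h ∙ h) eq) (residual-∙ h h)))
      -- The three lower bounds and `midpoint-bound` give 2 E n + E k ≤ E i + E j + E (suc k), where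
      -- E i and E j are at most E n.
      absurd : E k ≤ E (suc k)
      absurd = ≤-by (0≤+ (0≤+ (0≤y-x (≤-trans (+-mono-≤ (+-mono-≤ far-k far-j) far-i)
                  (midpoint-bound {residual (m i)} {residual (m j)} {residual (m (suc k))} {residual h} sum≈2h)))
                  (0≤y-x (E-antitone n≤i))) (0≤y-x (E-antitone (ℕ.≤-trans n≤i (ℕ.<⇒≤ i<j)))))
        (solve 5 (λ n i j k k′ → k :+ (((i :+ j :+ k′) :- (n :+ n :+ k)) :+ (n :- i) :+ (n :- j)) := k′) refl (E n) (E i) (E j) (E k) (E (suc k)))

    -- If n < i, both summands of q i + q j = q k are at least Q, while every denominator of the
    -- window is below 2Q.
    sorted-triple : ∀ {i j k} → n ℕ.≤ i → i ℕ.< j → j ℕ.< k → k ℕ.≤ N → IsDouble ((m i ∙ m j) ∙ m k) → i ≡ n × q n ℕ.+ q j ≡ q k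
    sorted-triple {i} {j} {k} n≤i i<j j<k k≤N double with i ℕ.≟ n
    ... | yes ≡.refl = ≡.refl , triple n≤i i<j j<k k≤N double
    ... | no i≢n = contradiction (≡.subst (Q ℕ.+ Q ℕ.≤_) (triple n≤i i<j j<k k≤N double) (ℕ.+-mono-≤ (q-mono n<i) (q-mono (ℕ.<-trans n<i i<j))))
                     (ℕ.<⇒≱ (q<x+2Q 0 k≤N))
      where
      n<i : n ℕ.< i
      n<i = ℕ.≤∧≢⇒< n≤i (i≢n ∘ ≡.sym)

    Partners : ℕ → ℕ → Set
    Partners j k = q n ℕ.+ q j ≡ q k ⊎ q n ℕ.+ q k ≡ q j

    -- Once coincidences are excluded, the least of the three indices must be n by `sorted-triple`.
    -- As j and k exceed n, it is i, and the order of j and k selects the alternative.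
    collision-partners : ∀ {i j k} → n ℕ.≤ i → i ℕ.≤ N → n ℕ.< j → j ℕ.≤ N → n ℕ.< k → k ℕ.≤ N →
                         m i ≡₂ m j ∙ m k → Partners j k
    collision-partners {i} {j} {k} n≤i i≤N n<j j≤N n<k k≤N i≡₂jk with ℕ.<-cmp i j | ℕ.<-cmp i k | ℕ.<-cmp j k
    ... | tri≈ _ ≡.refl _ | _ | _ = contradiction (x≡₂x∙y⇒IsDouble {m i} {m k} i≡₂jk) (not-double k)
    ... | _ | tri≈ _ ≡.refl _ | _ = contradiction (x≡₂x∙y⇒IsDouble {m i} {m j}
      (≡₂-respʳ {m i} {m j ∙ m i} {m i ∙ m j} (AbelianGroup.comm ℤ×L (m j) (m i)) i≡₂jk)) (not-double j)
    ... | _ | _ | tri≈ _ ≡.refl _ = contradiction (x≡₂y∙y⇒IsDouble {m i} {m j} i≡₂jk) (not-double i)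
    ... | tri< i<j _ _ | _ | tri< j<k _ _ =
      inj₁ (proj₂ (sorted-triple n≤i i<j j<k k≤N (x≡₂y∙z⇒IsDouble {m i} {m j} {m k} i≡₂jk)))
    ... | _ | tri< i<k _ _ | tri> _ _ k<j =
      inj₂ (proj₂ (sorted-triple n≤i i<k k<j j≤N (IsDouble-swapʳ (m i) (m j) (m k) (x≡₂y∙z⇒IsDouble {m i} {m j} {m k} i≡₂jk))))
    ... | tri> _ _ j<i | tri< i<k _ _ | _ =
      contradiction (≡.sym (proj₁ (sorted-triple (ℕ.<⇒≤ n<j) j<i i<k k≤N
        (IsDouble-swapˡ (m i) (m j) (m k) (x≡₂y∙z⇒IsDouble {m i} {m j} {m k} i≡₂jk))))) (ℕ.<⇒≢ n<j)
    ... | tri< i<j _ _ | tri> _ _ k<i | _ =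
      contradiction (≡.sym (proj₁ (sorted-triple (ℕ.<⇒≤ n<k) k<i i<j j≤N
        (IsDouble-swapˡ (m i) (m k) (m j) (IsDouble-swapʳ (m i) (m j) (m k) (x≡₂y∙z⇒IsDouble {m i} {m j} {m k} i≡₂jk)))))) (ℕ.<⇒≢ n<k)
    ... | tri> _ _ j<i | tri> _ _ k<i | tri< j<k _ _ =
      contradiction (≡.sym (proj₁ (sorted-triple (ℕ.<⇒≤ n<j) j<k k<i i≤N
        (IsDouble-swapʳ (m j) (m i) (m k) (IsDouble-swapˡ (m i) (m j) (m k) (x≡₂y∙z⇒IsDouble {m i} {m j} {m k} i≡₂jk)))))) (ℕ.<⇒≢ n<j)
    ... | tri> _ _ j<i | tri> _ _ k<i | tri> _ _ k<j =
      contradiction (≡.sym (proj₁ (sorted-triple (ℕ.<⇒≤ n<k) k<j j<i i≤N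
        (IsDouble-swapʳ (m k) (m i) (m j) (IsDouble-swapˡ (m i) (m k) (m j)
          (IsDouble-swapʳ (m i) (m j) (m k) (x≡₂y∙z⇒IsDouble {m i} {m j} {m k} i≡₂jk))))))) (ℕ.<⇒≢ n<k)

  -- The two-way recurrence for the denominators.

  module Recurrence (K : ℕ) (2ᵈ≡2K : 2 ℕ.^ d ≡ K ℕ.+ K) (1≤K : 1 ℕ.≤ K) where

    M : ℕ
    M = K ℕ.+ K

    partner : ∀ n → q (n ℕ.+ M) ℕ.< q (suc n) ℕ.+ q (suc n) → ∀ j → n ℕ.< j → j ℕ.≤ n ℕ.+ M →
              ∃[ k ] n ℕ.< k × k ℕ.≤ n ℕ.+ M × (q n ℕ.+ q j ≡ q k ⊎ q n ℕ.+ q k ≡ q j)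
    partner n narrow j n<j j≤N = from-pair (congruent-pairΛ (λ u → item (Fin.splitAt (suc M) u)) enough)
      where
      open Window n (n ℕ.+ M) narrow
      item : Fin (suc M) ⊎ Fin M → Λ
      item (inj₁ a) = m (n ℕ.+ toℕ a)
      item (inj₂ b) = m j ∙ m (suc n ℕ.+ toℕ b)
      enough : 2 ℕ.^ suc d ℕ.< suc M ℕ.+ M
      enough = s≤s (ℕ.≤-reflexive (≡.trans (≡.cong (2 ℕ.*_) 2ᵈ≡2K) (≡.cong (M ℕ.+_) (ℕ.+-identityʳ M))))
      n≤ : ∀ a → n ℕ.≤ n ℕ.+ a
      n≤ = ℕ.m≤m+n n
      a≤N : (a : Fin (suc M)) → n ℕ.+ toℕ a ℕ.≤ n ℕ.+ M
      a≤N a = ℕ.+-monoʳ-≤ n (ℕ.s≤s⁻¹ (Fin.toℕ<n a))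
      b≤N : (b : Fin M) → suc n ℕ.+ toℕ b ℕ.≤ n ℕ.+ M
      b≤N b = ≡.subst (ℕ._≤ n ℕ.+ M) (ℕ.+-suc n (toℕ b)) (ℕ.+-monoʳ-≤ n (Fin.toℕ<n b))
      n≤b : (b : Fin M) → n ℕ.≤ suc n ℕ.+ toℕ b
      n≤b b = ℕ.<⇒≤ (s≤s (n≤ (toℕ b)))
      -- Two items of the same family are incongruent, after cancelling `m j` in the second family,
      -- so the congruent pair must be mixed.
      resolve : ∀ s t → s ≢ t → item s ≡₂ item t →
                ∃[ k ] n ℕ.< k × k ℕ.≤ n ℕ.+ M × (q n ℕ.+ q j ≡ q k ⊎ q n ℕ.+ q k ≡ q j)
      resolve (inj₁ a) (inj₁ a′) a≢a′ c = contradiction c (incongruent (n≤ _) (a≤N a) (n≤ _) (a≤N a′)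
        λ eq → a≢a′ (≡.cong inj₁ (Fin.toℕ-injective (ℕ.+-cancelˡ-≡ n _ _ eq))))
      resolve (inj₁ a) (inj₂ b) _ c = _ , s≤s (n≤ _) , b≤N b ,
        collision-partners (n≤ _) (a≤N a) n<j j≤N (s≤s (n≤ _)) (b≤N b) c
      resolve (inj₂ b) (inj₁ a) _ c = _ , s≤s (n≤ _) , b≤N b ,
        collision-partners (n≤ _) (a≤N a) n<j j≤N (s≤s (n≤ _)) (b≤N b) (≡₂-sym {m j ∙ m (suc n ℕ.+ toℕ b)} {m (n ℕ.+ toℕ a)} c)
      resolve (inj₂ b) (inj₂ b′) b≢b′ c = contradiction (≡₂-cancelˡ (m j) {m (suc n ℕ.+ toℕ b)} {m (suc n ℕ.+ toℕ b′)} c)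
        (incongruent (n≤b b) (b≤N b) (n≤b b′) (b≤N b′)
        λ eq → b≢b′ (≡.cong inj₂ (Fin.toℕ-injective (ℕ.+-cancelˡ-≡ (suc n) _ _ eq))))
      from-pair : (∃₂ λ u v → u ≢ v × item (Fin.splitAt (suc M) u) ≡₂ item (Fin.splitAt (suc M) v)) →
                  ∃[ k ] n ℕ.< k × k ℕ.≤ n ℕ.+ M × (q n ℕ.+ q j ≡ q k ⊎ q n ℕ.+ q k ≡ q j)
      from-pair (u , v , u≢v , congruent) = resolve (Fin.splitAt (suc M) u) (Fin.splitAt (suc M) v)
        (λ s≡t → u≢v (≡.trans (≡.sym (Fin.join-splitAt (suc M) M u))
          (≡.trans (≡.cong (Fin.join (suc M) M) s≡t) (Fin.join-splitAt (suc M) M v)))) congruent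

    -- Since q k = q j - q n, different j have different partners k, but K + 1 indices j would share
    -- the K indices from n to n + K - 1.
    no-descending-partners : ∀ n → ¬ ((t : Fin (suc K)) → ∃[ k ] n ℕ.≤ k × k ℕ.< n ℕ.+ K × q n ℕ.+ q k ≡ q (n ℕ.+ (K ℕ.+ toℕ t)))
    no-descending-partners n smaller with Fin.pigeonhole (ℕ.n<1+n K) (λ t → Fin.fromℕ< (offset<K t))
      where
      offset<K : ∀ t → proj₁ (smaller t) ℕ.∸ n ℕ.< K
      offset<K t = let k , n≤k , k<n+K , _ = smaller t in
        ℕ.+-cancelˡ-< n _ _ (≡.subst (ℕ._< n ℕ.+ K) (≡.sym (ℕ.m+[n∸m]≡n n≤k)) k<n+K)
    ... | t , t′ , t<t′ , same-offset = ℕ.<⇒≢ (q-strict (ℕ.+-monoʳ-< n (ℕ.+-monoʳ-< K t<t′)))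
      (≡.trans (≡.sym (proj₂ (proj₂ (proj₂ (smaller t))))) (≡.trans (≡.cong (λ k → q n ℕ.+ q k) same-partner) (proj₂ (proj₂ (proj₂ (smaller t′))))))
      where
      same-partner : proj₁ (smaller t) ≡ proj₁ (smaller t′)
      same-partner = ℕ.∸-cancelʳ-≡ (proj₁ (proj₂ (smaller t))) (proj₁ (proj₂ (smaller t′)))
        (≡.trans (≡.sym (Fin.toℕ-fromℕ< _)) (≡.trans (≡.cong toℕ same-offset) (Fin.toℕ-fromℕ< _)))

    recurrence : ∀ n → q (suc n) ℕ.+ q (suc n) ℕ.≤ q (n ℕ.+ M) ⊎ q n ℕ.+ q (n ℕ.+ K) ℕ.≤ q (n ℕ.+ M)
    recurrence n with q (suc n) ℕ.+ q (suc n) ℕ.≤? q (n ℕ.+ M) | q n ℕ.+ q (n ℕ.+ K) ℕ.≤? q (n ℕ.+ M)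
    ... | yes wide | _        = inj₁ wide
    ... | no _     | yes long = inj₂ long
    ... | no ¬wide | no ¬long = contradiction (λ t → smaller t (partner n (ℕ.≰⇒> ¬wide) (n ℕ.+ (K ℕ.+ toℕ t))
                                  (ℕ.m<m+n n (ℕ.≤-trans 1≤K (ℕ.m≤m+n K _))) (j≤N t))) (no-descending-partners n)
      where
      j≤N : (t : Fin (suc K)) → n ℕ.+ (K ℕ.+ toℕ t) ℕ.≤ n ℕ.+ M
      j≤N t = ℕ.+-monoʳ-≤ n (ℕ.+-monoʳ-≤ K (ℕ.s≤s⁻¹ (Fin.toℕ<n t)))
      -- For j ≥ n + K, a partner with q k = q n + q j would give the excluded second inequality at
      -- once, and so would q j = q n + q k with k ≥ n + K.
      smaller : (t : Fin (suc K)) → let j = n ℕ.+ (K ℕ.+ toℕ t) in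
                ∃[ k ] n ℕ.< k × k ℕ.≤ n ℕ.+ M × (q n ℕ.+ q j ≡ q k ⊎ q n ℕ.+ q k ≡ q j) →
                ∃[ k ] n ℕ.≤ k × k ℕ.< n ℕ.+ K × q n ℕ.+ q k ≡ q j
      smaller t (k , n<k , k≤N , inj₁ eq) = contradiction (ℕ.≤-trans (ℕ.+-monoʳ-≤ (q n) (q-mono (ℕ.+-monoʳ-≤ n (ℕ.m≤m+n K (toℕ t)))))
                                        (≡.subst (ℕ._≤ q (n ℕ.+ M)) (≡.sym eq) (q-mono k≤N))) ¬long
      smaller t (k , n<k , k≤N , inj₂ eq) = k , ℕ.<⇒≤ n<k , ℕ.≰⇒> (λ n+K≤k → ¬long (ℕ.≤-trans (ℕ.+-monoʳ-≤ (q n) (q-mono n+K≤k))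
                                        (≡.subst (ℕ._≤ q (n ℕ.+ M)) (≡.sym eq) (q-mono (j≤N t))))) , eq

-- From the recurrence to exponential growth.

module Growth (em : ExcludedMiddle 0ℓ) (ℝ : CompleteOrderedField) where
  open CompleteOrderedField ℝ hiding (zero)
  open RealFunctions em ℝ
  open OrderedField em ℝ
  open Roots em ℝ
  open AddExtrema _≤_ using ([≤]-injective; ≤±-minimum; ≤±-maximum) renaming ([_] to [_]≤)

  module _ {q : ℕ → ℕ} (1≤q : ∀ n → 1 ℕ.≤ q n) {K : ℕ} (1≤K : 1 ℕ.≤ K)
           (recurrence : ∀ n → q (suc n) ℕ.+ q (suc n) ℕ.≤ q (n ℕ.+ (K ℕ.+ K)) ⊎ q n ℕ.+ q (n ℕ.+ K) ℕ.≤ q (n ℕ.+ (K ℕ.+ K)))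
           {y : Carrier} (1≤y : 1# ≤ y)
           (yᴹ≤2y : y ^ (K ℕ.+ K) ≤ y + y) (yᴹ≤1+yᴷ : y ^ (K ℕ.+ K) ≤ 1# + y ^ K) where

    private
      M : ℕ
      M = K ℕ.+ K
      Y : Carrier
      Y = y ^ M
      0≤y : 0# ≤ y
      0≤y = ≤-trans 0≤1 1≤y
      0≤Y : 0# ≤ Y
      0≤Y = 0≤^ M 0≤y
      open PosetReasoning poset

    add-bounds : ∀ {a b c s t} → s ≤ Y * fromℕ a → t ≤ Y * fromℕ b → a ℕ.+ b ℕ.≤ c → s + t ≤ Y * fromℕ c
    add-bounds {a} {b} {c} {s} {t} s≤ t≤ a+b≤c = begin
      s + t                          ≤⟨ +-mono-≤ s≤ t≤ ⟩
      Y * fromℕ a + Y * fromℕ b      ≈⟨ trans (*-congˡ (fromℕ-+ a b)) (distribˡ Y _ _) ⟨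
      Y * fromℕ (a ℕ.+ b)            ≤⟨ *-monoʳ-≤ 0≤Y (fromℕ-mono-≤ a+b≤c) ⟩
      Y * fromℕ c                    ∎

    growth-step : ∀ n → y ^ suc n ≤ Y * fromℕ (q (suc n)) → y ^ n ≤ Y * fromℕ (q n) →
                  y ^ (n ℕ.+ K) ≤ Y * fromℕ (q (n ℕ.+ K)) → y ^ (n ℕ.+ M) ≤ Y * fromℕ (q (n ℕ.+ M))
    growth-step n next here mid with recurrence n
    ... | inj₁ wide = begin
      y ^ (n ℕ.+ M)          ≈⟨ ^-homo-* y n M ⟩
      y ^ n * Y              ≤⟨ *-monoʳ-≤ (0≤^ n 0≤y) yᴹ≤2y ⟩
      y ^ n * (y + y)        ≈⟨ trans (distribˡ _ y y) (+-cong (*-comm _ y) (*-comm _ y)) ⟩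
      y ^ suc n + y ^ suc n  ≤⟨ add-bounds {q (suc n)} {q (suc n)} next next wide ⟩
      Y * fromℕ (q (n ℕ.+ M)) ∎
    ... | inj₂ long = begin
      y ^ (n ℕ.+ M)          ≈⟨ ^-homo-* y n M ⟩
      y ^ n * Y              ≤⟨ *-monoʳ-≤ (0≤^ n 0≤y) yᴹ≤1+yᴷ ⟩
      y ^ n * (1# + y ^ K)   ≈⟨ trans (distribˡ _ _ _) (+-cong (*-identityʳ _) (sym (^-homo-* y n K))) ⟩
      y ^ n + y ^ (n ℕ.+ K)  ≤⟨ add-bounds {q n} {q (n ℕ.+ K)} here mid long ⟩
      Y * fromℕ (q (n ℕ.+ M)) ∎

    -- The factor Y = y^M pays for the indices below M, which the recurrence does not reach: there
    -- yⁿ ≤ Y and q n ≥ 1.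
    exponential-growth : ∀ n → y ^ n ≤ Y * fromℕ (q n)
    exponential-growth = <-rec (λ n → y ^ n ≤ Y * fromℕ (q n)) step
      where
      step : ∀ n → (∀ {k} → k ℕ.< n → y ^ k ≤ Y * fromℕ (q k)) → y ^ n ≤ Y * fromℕ (q n)
      step n rec with M ℕ.≤? n
      ... | no M≰n = begin
        y ^ n              ≤⟨ ^-monoʳ-≤ {m = n} {n = M} 1≤y (ℕ.<⇒≤ (ℕ.≰⇒> M≰n)) ⟩
        Y                  ≈⟨ *-identityʳ Y ⟨
        Y * 1#             ≤⟨ *-monoʳ-≤ 0≤Y (1≤fromℕ {q n} (1≤q n)) ⟩
        Y * fromℕ (q n)    ∎
      ... | yes M≤n = ≡.subst (λ n → y ^ n ≤ Y * fromℕ (q n)) k+M≡n (growth-step k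
        -- K ≥ 1 gives M ≥ 2, so the index k + 1 is strictly below n = k + M.
        (rec (≡.subst (suc k ℕ.<_) k+M≡n (≡.subst (ℕ._≤ k ℕ.+ M) (ℕ.+-comm k 2) (ℕ.+-monoʳ-≤ k (ℕ.+-mono-≤ 1≤K 1≤K)))))
        (rec (≡.subst (k ℕ.<_) k+M≡n (ℕ.m<m+n k (ℕ.≤-trans 1≤K (ℕ.m≤m+n K K)))))
        (rec (≡.subst (k ℕ.+ K ℕ.<_) k+M≡n (ℕ.+-monoʳ-< k (ℕ.m<m+n K 1≤K)))))
        where
        k : ℕ
        k = n ℕ.∸ M
        k+M≡n : k ℕ.+ M ≡ n
        k+M≡n = ℕ.m∸n+n≡m M≤n

  -- Bernoulli's inequality for 1 + h/x, cleared of denominators.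
  bernoulli : ∀ {x h} → 0# ≤ x → 0# ≤ h → ∀ n → x ^ n * (x + fromℕ n * h) ≤ x * (x + h) ^ n
  bernoulli {x} {h} 0≤x 0≤h zero = ≤-reflexive (trans (*-identityˡ _) (trans (+-congˡ (zeroˡ h)) (trans (+-identityʳ x) (sym (*-identityʳ x)))))
  bernoulli {x} {h} 0≤x 0≤h (suc n) = begin
    (x * x ^ n) * (x + (1# + fromℕ n) * h)     ≤⟨ ≤-by (*-nonNeg (0≤^ n 0≤x) (*-nonNeg (*-nonNeg (0≤fromℕ n) 0≤h) 0≤h))
      (solve 5 (λ x h o k p → (x :* p) :* (x :+ (o :+ k) :* h) :+ p :* ((k :* h) :* h)
                             := p :* (x :* (x :+ k :* h) :+ o :* x :* h :+ h :* (k :* h))) refl x h 1# (fromℕ n) (x ^ n)) ⟩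
    x ^ n * (x * (x + fromℕ n * h) + 1# * x * h + h * (fromℕ n * h))
      ≈⟨ *-congˡ (+-congʳ (+-congˡ (*-congʳ (*-identityˡ x)))) ⟩
    x ^ n * (x * (x + fromℕ n * h) + x * h + h * (fromℕ n * h))
      ≈⟨ solve 4 (λ x h k p → p :* (x :* (x :+ k :* h) :+ x :* h :+ h :* (k :* h)) := (x :+ h) :* (p :* (x :+ k :* h))) refl x h (fromℕ n) (x ^ n) ⟩
    (x + h) * (x ^ n * (x + fromℕ n * h))      ≤⟨ *-monoʳ-≤ (0≤+ 0≤x 0≤h) (bernoulli 0≤x 0≤h n) ⟩
    (x + h) * (x * (x + h) ^ n)                ≈⟨ solve 3 (λ x s p → s :* (x :* p) := x :* (s :* p)) refl x (x + h) ((x + h) ^ n) ⟩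
    x * (x + h) ^ suc n                        ∎
    where open PosetReasoning poset

  -- By Bernoulli (y/x)ⁿ grows at least linearly and so passes the constant xY. The extra factor x
  -- is there because `q n`, indexed from 0, has its root of order n + 1 taken.
  eventually-≥-power : ∀ {x y Y} {q : ℕ → ℕ} → 0# < x → x < y → 0# < Y → (∀ n → y ^ n ≤ Y * fromℕ (q n)) →
                       ∃[ N ] ∀ n → N ℕ.≤ n → x ^ suc n ≤ fromℕ (q n)
  eventually-≥-power {x} {y} {Y} {q} 0<x x<y 0<Y growth = N , λ n N≤n → *-cancelˡ-≤ (0<x*y 0<x 0<Y) (begin
    (x * Y) * x ^ suc n                  ≈⟨ solve 3 (λ x Y p → (x :* Y) :* (x :* p) := p :* ((x :* x) :* Y)) refl x Y (x ^ n) ⟩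
    x ^ n * ((x * x) * Y)                ≤⟨ *-monoʳ-≤ (0≤^ n (<⇒≤ 0<x)) (large n N≤n) ⟩
    x ^ n * (x + fromℕ n * (y - x))      ≤⟨ bernoulli (<⇒≤ 0<x) (<⇒≤ (0<y-x x<y)) n ⟩
    x * (x + (y - x)) ^ n                ≈⟨ *-congˡ (^-congˡ n (solve 2 (λ x y → x :+ (y :- x) := y) refl x y)) ⟩
    x * y ^ n                            ≤⟨ *-monoʳ-≤ (<⇒≤ 0<x) (growth n) ⟩
    x * (Y * fromℕ (q n))                ≈⟨ *-assoc x Y _ ⟨
    (x * Y) * fromℕ (q n)                ∎)
    where
    open PosetReasoning poset
    multiple : ∃[ N ] (x * x) * Y < fromℕ N * (y - x)
    multiple = archimedean ((x * x) * Y) (0<y-x x<y)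
    N : ℕ
    N = proj₁ multiple
    large : ∀ n → N ℕ.≤ n → (x * x) * Y ≤ x + fromℕ n * (y - x)
    large n N≤n = begin
      (x * x) * Y                 ≤⟨ <⇒≤ (proj₂ multiple) ⟩
      fromℕ N * (y - x)           ≤⟨ *-mono-≤ (0≤fromℕ N) (<⇒≤ (0<y-x x<y)) (fromℕ-mono-≤ N≤n) ≤-refl ⟩
      fromℕ n * (y - x)           ≤⟨ ≤-by (<⇒≤ 0<x) (+-comm _ x) ⟩
      x + fromℕ n * (y - x)       ∎

  -- Existence and lower bounds of the limit inferior.

  Eventually≤ : Carrier → (ℕ → Carrier) → Set
  Eventually≤ x a = ∃[ N ] ∀ n → N ℕ.≤ n → x ≤ a n

  between : ∀ {x y} → x < y → ∃[ z ] x < z × z < y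
  between {x} {y} x<y = let z , 2z≈x+y = divide (x + y) 0<2 in z ,
    ≰⇒> (λ z≤x → <⇒≱ x<y (≤-by (0≤+ (0≤y-x z≤x) (0≤y-x z≤x))
      (trans (solve 3 (λ x y z → y :+ ((x :- z) :+ (x :- z)) := (x :+ y) :+ x :- :2 :* z) refl x y z)
        (trans (+-congˡ (-‿cong 2z≈x+y)) (solve 2 (λ x y → (x :+ y) :+ x :- (x :+ y) := x) refl x y))))) ,
    ≰⇒> (λ y≤z → <⇒≱ x<y (≤-by (0≤+ (0≤y-x y≤z) (0≤y-x y≤z))
      (trans (solve 3 (λ x y z → y :+ ((z :- y) :+ (z :- y)) := :2 :* z :- y) refl x y z)
        (trans (+-congʳ 2z≈x+y) (solve 2 (λ x y → (x :+ y) :- y := x) refl x y)))))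

  module _ (a : ℕ → Carrier) (0≤a : ∀ n → 0# ≤ a n) where

    TailBound : ℕ → Pred Carrier 0ℓ
    TailBound N x = ∀ n → N ℕ.≤ n → x ≤ a n

    -- Completeness speaks of suprema, so the infimum of a tail is obtained as the supremum of its
    -- lower bounds, among which is 0.
    tail-infimum : ∀ N → ∃ (IsSup _≤_ (TailBound N))
    tail-infimum N = complete (TailBound N) (0# , λ n _ → 0≤a n) (a N , λ x x≤ → x≤ N ℕ.≤-refl)

    inf : ℕ → Carrier
    inf N = proj₁ (tail-infimum N)

    inf-upper : ∀ N {x} → TailBound N x → x ≤ inf N
    inf-upper N x∈ = proj₁ (proj₂ (tail-infimum N)) _ x∈

    inf-lower : ∀ N → TailBound N (inf N)
    inf-lower N n N≤n = proj₂ (proj₂ (tail-infimum N)) (a n) λ x x∈ → x∈ n N≤n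

    inf-isInf : ∀ N → IsInf _≤±_ (λ y → ∃[ k ] N ℕ.≤ k × y ≡ [ a k ]) [ inf N ]
    inf-isInf N = (λ { _ (k , N≤k , ≡.refl) → [ inf-lower N k N≤k ]≤ }) , greatest
      where
      greatest : ∀ l → IsLowerBound _≤±_ (λ y → ∃[ k ] N ℕ.≤ k × y ≡ [ a k ]) l → l ≤± [ inf N ]
      greatest ⊥± _ = ≤±-minimum _
      greatest ⊤± lower with lower [ a N ] (N , ℕ.≤-refl , ≡.refl)
      ... | ()
      greatest [ x ] lower = [ inf-upper N (λ n N≤n → [≤]-injective (lower [ a n ] (n , N≤n , ≡.refl))) ]≤

    Infs : Pred Carrier 0ℓ
    Infs y = ∃[ N ] y ≡ inf N

    -- The limit inferior is `⊤±` when the tail infima are unbounded, and otherwise their supremum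
    -- s. If s < g, a number strictly between would eventually lie below the sequence, hence below
    -- some tail infimum.
    liminf-≥ : ∀ {g} → (∀ x → x < g → Eventually≤ x a) → ∃[ ℓ ] IsLiminf a ℓ × [ g ] ≤± ℓ
    liminf-≥ {g} eventually with em {∃ (IsUpperBound _≤_ Infs)}
    ... | no unbounded = ⊤± , (_ , inf-isInf , (λ y _ → ≤±-maximum y) , least) , ≤±-maximum _
      where
      least : ∀ u → IsUpperBound _≤±_ (λ y → ∃[ N ] y ≡ [ inf N ]) u → ⊤± ≤± u
      least ⊥± upper with upper [ inf 0 ] (0 , ≡.refl)
      ... | AddSupremum.[ () ]
      least [ u ] upper = contradiction (u , λ { _ (N , ≡.refl) → [≤]-injective (upper [ inf N ] (N , ≡.refl)) }) unbounded
      least ⊤± _ = ≤±-maximum _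
    ... | yes bounded = [ s ] , (_ , inf-isInf , (λ { _ (N , ≡.refl) → [ s-upper _ (N , ≡.refl) ]≤ }) , least) , [ g≤s ]≤
      where
      supremum : ∃ (IsSup _≤_ Infs)
      supremum = complete Infs (inf 0 , 0 , ≡.refl) bounded
      s : Carrier
      s = proj₁ supremum
      s-upper : IsUpperBound _≤_ Infs s
      s-upper = proj₁ (proj₂ supremum)
      least : ∀ u → IsUpperBound _≤±_ (λ y → ∃[ N ] y ≡ [ inf N ]) u → [ s ] ≤± u
      least ⊥± upper with upper [ inf 0 ] (0 , ≡.refl)
      ... | AddSupremum.[ () ]
      least [ u ] upper = [ proj₂ (proj₂ supremum) u (λ { _ (N , ≡.refl) → [≤]-injective (upper [ inf N ] (N , ≡.refl)) }) ]≤
      least ⊤± _ = ≤±-maximum _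
      g≤s : g ≤ s
      g≤s = ≮⇒≥ λ s<g → let x , s<x , x<g = between s<g
                            N , x≤a = eventually x x<g
                        in <⇒≱ s<x (≤-trans (inf-upper N x≤a) (s-upper _ (N , ≡.refl)))

  -- Admissible rates below the growth bound, and the conclusion.

  ⁻¹-inverse : ∀ {x} → x ≉ 0# → x * x ⁻¹ ≈ 1#
  ⁻¹-inverse {x} x≉0 with em {x ≈ 0#}
  ... | yes x≈0  = contradiction x≈0 x≉0
  ... | no x≉0′ = proj₂ (inverse x x≉0′)

  -- A member of the set defining the root supplies a rate that satisfies the power inequality and
  -- still lies strictly above x.
  root-exceeds : ∀ n {x X} → 0# ≤ X → x < root (suc n) X → ∃[ y ] 0# ≤ y × y ^ suc n ≤ X × x < y
  root-exceeds n {x} {X} 0≤X x<root with em {∃[ y ] 0# ≤ y × y ^ suc n ≤ X × x < y}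
  ... | yes found = found
  ... | no none = contradiction (root-least n 0≤X λ y 0≤y yⁿ≤X → ≮⇒≥ λ x<y → none (y , 0≤y , yⁿ≤X , x<y)) (<⇒≱ x<root)

  AdmissibleRate : ℕ → Carrier → Set
  AdmissibleRate K y = y ^ (K ℕ.+ K) ≤ y + y × y ^ (K ℕ.+ K) ≤ 1# + y ^ K

  growthBound-admissible : ∀ d′ {x} → 1# ≤ x → x < growthBound (suc d′) → ∃[ y ] x < y × AdmissibleRate (2 ℕ.^ d′) y
  growthBound-admissible zero {x} 1≤x x<φ =
    y , x<y , ≤-respˡ (sym (x^2≈x*x y)) (≤-trans yy≤1+y (+-monoˡ-≤ y 1≤y)) ,
    ≤-respˡ (sym (x^2≈x*x y)) (≤-respʳ (+-congˡ (sym (*-identityʳ y))) yy≤1+y)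
    where
    open PosetReasoning poset
    2·2⁻¹ : fromℕ 2 * fromℕ 2 ⁻¹ ≈ 1#
    2·2⁻¹ = ⁻¹-inverse (λ 2≈0 → proj₂ 0<2 (sym 2≈0))
    2x-1<√5 : fromℕ 2 * x - 1# < √ fromℕ 5
    2x-1<√5 = ≰⇒> λ √5≤2x-1 → <⇒≱ x<φ (*-cancelˡ-≤ 0<2 (begin
      fromℕ 2 * ((1# + √ fromℕ 5) * fromℕ 2 ⁻¹)   ≈⟨ solve 3 (λ t s i → t :* (s :* i) := s :* (t :* i)) refl (fromℕ 2) (1# + √ fromℕ 5) (fromℕ 2 ⁻¹) ⟩
      (1# + √ fromℕ 5) * (fromℕ 2 * fromℕ 2 ⁻¹)   ≈⟨ trans (*-congˡ 2·2⁻¹) (*-identityʳ _) ⟩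
      1# + √ fromℕ 5                              ≤⟨ +-mono-≤ ≤-refl √5≤2x-1 ⟩
      1# + (fromℕ 2 * x - 1#)                     ≈⟨ solve 2 (λ e t → e :+ (t :- e) := t) refl 1# (fromℕ 2 * x) ⟩
      fromℕ 2 * x                                 ∎))
    exceeding : ∃[ z ] 0# ≤ z × z ^ 2 ≤ fromℕ 5 × fromℕ 2 * x - 1# < z
    exceeding = root-exceeds 1 (0≤fromℕ 5) 2x-1<√5
    z : Carrier
    z = proj₁ exceeding
    zz≤5 : z * z ≤ fromℕ 5
    zz≤5 = ≤-respˡ (x^2≈x*x z) (proj₁ (proj₂ (proj₂ exceeding)))
    -- y is chosen with z = 2y - 1, so that z² ≤ 5 becomes four times y² ≤ 1 + y.
    y : Carrier
    y = proj₁ (divide (1# + z) 0<2)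
    2y≈1+z : fromℕ 2 * y ≈ 1# + z
    2y≈1+z = proj₂ (divide (1# + z) 0<2)
    x<y : x < y
    x<y = ≰⇒> λ y≤x → <⇒≱ (proj₂ (proj₂ (proj₂ exceeding))) (begin
      z                      ≈⟨ solve 2 (λ e z → z := (e :+ z) :- e) refl 1# z ⟩
      (1# + z) - 1#          ≈⟨ +-congʳ 2y≈1+z ⟨
      fromℕ 2 * y - 1#       ≤⟨ +-monoˡ-≤ (- 1#) (*-monoʳ-≤ (0≤fromℕ 2) y≤x) ⟩
      fromℕ 2 * x - 1#       ∎)
    1≤y : 1# ≤ y
    1≤y = ≤-trans 1≤x (<⇒≤ x<y)
    z≈2y-1 : z ≈ fromℕ 2 * y - 1#
    z≈2y-1 = trans (solve 2 (λ e z → z := (e :+ z) :- e) refl 1# z) (+-congʳ (sym 2y≈1+z))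
    yy≤1+y : y * y ≤ 1# + y
    yy≤1+y = *-cancelˡ-≤ (0<x*y 0<2 0<2) (≤-by (0≤y-x zz≤5) (begin-equality
      (fromℕ 2 * fromℕ 2) * (y * y) + (fromℕ 5 - z * z)
        ≈⟨ +-congˡ (+-congˡ (-‿cong (*-cong z≈2y-1′ z≈2y-1′))) ⟩
      (fromℕ 2 * fromℕ 2) * (y * y) + (fromℕ 5 - (fromℕ 2 * y - fromℕ 1) * (fromℕ 2 * y - fromℕ 1))
        ≈⟨ solve 1 (λ y → (:2 :* :2) :* (y :* y) :+ (con (+ 5) :- (:2 :* y :- :1) :* (:2 :* y :- :1)) := (:2 :* :2) :* (:1 :+ y)) refl y ⟩
      (fromℕ 2 * fromℕ 2) * (fromℕ 1 + y)       ≈⟨ *-congˡ (+-congʳ fromℕ-1) ⟩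
      (fromℕ 2 * fromℕ 2) * (1# + y)            ∎))
      where
      z≈2y-1′ : z ≈ fromℕ 2 * y - fromℕ 1
      z≈2y-1′ = trans z≈2y-1 (+-congˡ (-‿cong (sym fromℕ-1)))
  growthBound-admissible (suc d′) {x} 1≤x x<root =
    let y , 0≤y , yᵐ≤2 , x<y = root-exceeds m (0≤fromℕ 2) (≡.subst (λ k → x < root k (fromℕ 2)) exponent x<root)
        1≤y = ≤-trans 1≤x (<⇒≤ x<y)
        y^M≤2y : y ^ (K ℕ.+ K) ≤ y + y
        y^M≤2y = begin
          y ^ (K ℕ.+ K)          ≡⟨ ≡.cong (y ^_) K+K≡2+m ⟩
          y * y ^ suc m          ≤⟨ *-monoʳ-≤ 0≤y yᵐ≤2 ⟩
          y * fromℕ 2            ≈⟨ solve 1 (λ y → y :* :2 := y :+ y) refl y ⟩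
          y + y                  ∎
    in y , x<y , y^M≤2y , (begin
      y ^ (K ℕ.+ K)              ≤⟨ y^M≤2y ⟩
      y + y                      ≤⟨ ≤-by (0≤x² (y - fromℕ 1)) (solve 1 (λ y → (y :+ y) :+ (y :- :1) :* (y :- :1) := :1 :+ y :* y) refl y) ⟩
      fromℕ 1 + y * y            ≈⟨ +-cong fromℕ-1 (sym (x^2≈x*x y)) ⟩
      1# + y ^ 2                 ≤⟨ +-mono-≤ ≤-refl (^-monoʳ-≤ {m = 2} {n = K} 1≤y (ℕ.^-monoʳ-≤ 2 (s≤s (z≤n {d′})))) ⟩
      1# + y ^ K                 ∎)
    where
    open PosetReasoning poset
    K m : ℕ
    K = 2 ℕ.^ suc d′
    -- `suc m` is M - 1 = 2^d - 1, the order of the root in the bound; the facts about roots are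
    -- stated for successor orders.
    m = 2 ℕ.* K ℕ.∸ 2
    2≤2K : 2 ℕ.≤ 2 ℕ.* K
    2≤2K = ℕ.*-monoʳ-≤ 2 (ℕ.m^n>0 2 (suc d′))
    exponent : 2 ℕ.* K ℕ.∸ 1 ≡ suc m
    exponent = ℕ.+-∸-assoc 1 2≤2K
    K+K≡2+m : K ℕ.+ K ≡ suc (suc m)
    K+K≡2+m = ≡.trans (≡.cong (K ℕ.+_) (≡.sym (ℕ.+-identityʳ K))) (≡.sym (ℕ.m+[n∸m]≡n 2≤2K))

corollary3p3 :
    (em : ExcludedMiddle 0ℓ) (ℝ : CompleteOrderedField) (V : InnerProductSpace ℝ) →
    let open CompleteOrderedField ℝ
        open RealFunctions em ℝ
        open InnerProductSpace V
        open Approximation em ℝ V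
    in
    (d : ℕ) → 1 ℕ.≤ d → HasDimension d →
    (L : Pred Carrierᴹ 0ℓ) → IsFullRankLattice L →
    (α : Carrierᴹ) (q : ℕ → ℕ) → IsBestApproximationSequence L α q →
    ∃[ ℓ ] IsLiminf (λ n → root (suc n) (fromℕ (q n))) ℓ × [ growthBound d ] ≤± ℓ
corollary3p3 em ℝ V (suc d′) _ dimension L lattice α q sequence =
  liminf-≥ (λ n → root (suc n) (fromℕ (q n))) (λ n → 0≤root n (0≤fromℕ (q n))) eventually
  where
  open CompleteOrderedField ℝ using (1#; 0#; _<_; _≤_; fromℕ)
  open RealFunctions em ℝ
  open OrderedField em ℝ
  open Roots em ℝ
  open Growth em ℝ
  f = proj₁ (InnerProducts.coordinates em ℝ V dimension)
  e = proj₁ (proj₂ (InnerProducts.coordinates em ℝ V dimension))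
  open BestApproximations em ℝ V lattice f e (proj₂ (proj₂ (InnerProducts.coordinates em ℝ V dimension))) sequence
    using (1≤q; module Recurrence)
  K : ℕ
  K = 2 ℕ.^ d′
  1≤K : 1 ℕ.≤ K
  1≤K = ℕ.m^n>0 2 d′
  open Recurrence K (≡.cong (K ℕ.+_) (ℕ.+-identityʳ K)) 1≤K using (recurrence)
  eventually : ∀ x → x < growthBound (suc d′) → Eventually≤ x (λ n → root (suc n) (fromℕ (q n)))
  -- The growth estimate concerns rates of at least 1. For x ≤ 1 every term already reaches x,
  -- because q n ≥ 1.
  eventually x x<g with total x 1#
  ... | inj₁ x≤1 = 0 , λ n _ → ≤-trans x≤1 (root-upper n 0≤1 (≤-trans (1^≤1 n) (1≤fromℕ {q n} (1≤q n))))
    where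
    open CompleteOrderedField ℝ using (_^_; *-identityˡ)
    1^≤1 : ∀ n → 1# ^ suc n ≤ 1#
    1^≤1 zero    = ≤-reflexive (*-identityˡ 1#)
    1^≤1 (suc n) = ≤-respˡ (CompleteOrderedField.sym ℝ (*-identityˡ _)) (1^≤1 n)
  ... | inj₂ 1≤x =
    let y , x<y , yᴹ≤2y , yᴹ≤1+yᴷ = growthBound-admissible d′ 1≤x x<g
        1≤y = ≤-trans 1≤x (<⇒≤ x<y)
        0<x = <-≤-trans 0<1 1≤x
        N , power≤ = eventually-≥-power {q = q} 0<x x<y (0<^ (K ℕ.+ K) (<-≤-trans 0<1 1≤y))
                       (exponential-growth 1≤q 1≤K recurrence 1≤y yᴹ≤2y yᴹ≤1+yᴷ)
    in N , λ n N≤n → root-upper n (<⇒≤ 0<x) (power≤ n N≤n)
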